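{- Consider the non-isomorphic linear orders $M=(\mathbb{R},<)$ and $N=(\mathbb{R}\setminus\{0\},<)$ as metric structures with the discrete metric. Then $L^1([0,1],M)\cong L^1([0,1],N)$, where $[0,1]$ is regarded as a probability measure space with the Lebesgue measure.
   Context: A discrete first-order structure is viewed as a metric structure with the discrete $\{0,1\}$-valued metric and $\{0,1\}$-valued predicates; here the language has a single binary predicate symbol $<$. For a probability space $(\Omega,\mu)$ and a metric structure $M$ in a language $\mathcal{L}$, a simple section is a function $\Omega\to M$ that is constant on each piece of a finite measurable partition of $\Omega$; a measurable section is a function $f:\Omega\to M$ that is $\mu$-a.e. the pointwise limit of a sequence of simple sections. $L^1(\Omega,M)$ is the set of measurable sections modulo a.e. equality, with metric $d(f,g)=\int_\Omega d^M(f(\omega),g(\omega))\,d\mu(\omega)$; it is an $\mathcal{L}$-structure in which a predicate symbol $R$ is interpreted by $R(\bar f)=\int_\Omega R^M(\bar f(\omega))\,d\mu(\omega)$. Isomorphisms of metric structures are surjective isometries preserving all symbols of the language. -}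

module Defs where

open import Axiom.ExcludedMiddle using (ExcludedMiddle)
open import Data.Bool using (Bool; true; T; if_then_else_)
open import Data.Empty using (⊥-elim)
open import Data.Fin as Fin using (Fin; toℕ)
open import Data.Nat as ℕ using (ℕ)
open import Data.Product using (∃; ∃₂; Σ-syntax; ∃-syntax; _×_; _,_; proj₁; proj₂)
open import Data.Rational as ℚ using (ℚ; 0ℚ; 1ℚ; _*_; _-_)
import Data.Rational.Properties as ℚ
open import Data.Sum using (inj₁; inj₂)
open import Function using (_∘_; Func; Surjective)
open import Level using (0ℓ)
open import Relation.Binary using
  (Setoid; StrictTotalOrder; IsEquivalence; Trichotomous; tri<; tri≈; tri>)
import Relation.Binary.Construct.On as On
open import Relation.Binary.PropositionalEquality as ≡ using (_≡_; refl; cong; subst)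
open import Relation.Nullary using (¬_; yes; no)
open import Relation.Nullary.Decidable using (⌊_⌋; toWitness; fromWitness)
open import Relation.Unary using (Pred; _∩_; _∪_; ∁; U; ∅; _⊆_)

open import Algebra.Properties.Monoid.Sum ℚ.+-0-monoid using (sum-syntax)

-- A real number is a lower Dedekind cut of ℚ without greatest element.
-- Cuts, and likewise the subsets of [0,1] below, are Bool-valued so that
-- they form types in Set; under excluded middle this is no restriction.

record ℝ : Set where
  field
    lower     : ℚ → Bool
    inhabited : ∃[ q ] T (lower q)
    proper    : ∃[ q ] ¬ T (lower q)
    downward  : ∀ {p q} → p ℚ.< q → T (lower q) → T (lower p)
    rounded   : ∀ {q} → T (lower q) → ∃[ r ] q ℚ.< r × T (lower r)

open ℝ

infix 4 _∈_ _≤_ _<_ _≈_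

_∈_ : ℚ → ℝ → Set
q ∈ x = T (lower x q)

_≤_ _<_ _≈_ : ℝ → ℝ → Set
x ≤ y = ∀ q → q ∈ x → q ∈ y
x < y = ∃[ q ] q ∈ y × ¬ q ∈ x
x ≈ y = x ≤ y × y ≤ x

≈-isEquivalence : IsEquivalence _≈_
≈-isEquivalence = record
  { refl  = (λ _ q∈x → q∈x) , (λ _ q∈x → q∈x)
  ; sym   = λ (x≤y , y≤x) → y≤x , x≤y
  ; trans = λ (x≤y , y≤x) (y≤z , z≤y) →
      (λ q q∈x → y≤z q (x≤y q q∈x)) , (λ q q∈z → y≤x q (z≤y q q∈z))
  }

q+[p-q]≡p : ∀ p q → q ℚ.+ (p - q) ≡ p
q+[p-q]≡p p q = begin
  q ℚ.+ (p - q)        ≡⟨ ℚ.+-comm q (p - q) ⟩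
  p - q ℚ.+ q          ≡⟨ ℚ.+-assoc p (ℚ.- q) q ⟩
  p ℚ.+ (ℚ.- q ℚ.+ q)  ≡⟨ cong (p ℚ.+_) (ℚ.+-inverseˡ q) ⟩
  p ℚ.+ 0ℚ             ≡⟨ ℚ.+-identityʳ p ⟩
  p                    ∎
  where open ≡.≡-Reasoning

0≤* : ∀ {p q} → 0ℚ ℚ.≤ p → 0ℚ ℚ.≤ q → 0ℚ ℚ.≤ p * q
0≤* {p} {q} 0≤p 0≤q = subst (ℚ._≤ p * q) (ℚ.*-zeroʳ p) (ℚ.*-monoˡ-≤-nonNeg p {{ℚ.nonNegative 0≤p}} 0≤q)

0≤∑ : ∀ n {t : Fin n → ℚ} → (∀ i → 0ℚ ℚ.≤ t i) → 0ℚ ℚ.≤ ∑[ i < n ] t i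
0≤∑ ℕ.zero    0≤t = ℚ.≤-refl
0≤∑ (ℕ.suc n) 0≤t = ℚ.+-mono-≤ (0≤t Fin.zero) (0≤∑ n (0≤t ∘ Fin.suc))

∈∧∉⇒< : ∀ x {p q} → p ∈ x → ¬ q ∈ x → p ℚ.< q
∈∧∉⇒< x {p} {q} p∈x q∉x with ℚ.<-cmp p q
... | tri< p<q _    _   = p<q
... | tri≈ _   refl _   = ⊥-elim (q∉x p∈x)
... | tri> _   _    q<p = ⊥-elim (q∉x (downward x q<p p∈x))

fromℚ : ℚ → ℝ
fromℚ q = record
  { lower     = λ r → ⌊ r ℚ.<? q ⌋
  ; inhabited = q - 1ℚ , fromWitness
      (subst (q - 1ℚ ℚ.<_) (ℚ.+-identityʳ q) (ℚ.+-monoʳ-< q (ℚ.negative⁻¹ (ℚ.- 1ℚ))))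
  ; proper    = q , λ q<q → ℚ.<-irrefl refl (toWitness q<q)
  ; downward  = λ p<r r<q → fromWitness (ℚ.<-trans p<r (toWitness r<q))
  ; rounded   = λ p<q → let (r , p<r , r<q) = ℚ.<-dense (toWitness p<q) in r , p<r , fromWitness r<q
  }

fromℚ-cancel-≤ : ∀ {p q} → fromℚ p ≤ fromℚ q → p ℚ.≤ q
fromℚ-cancel-≤ {p} {q} p≤q = ℚ.≮⇒≥ λ q<p → ℚ.<-irrefl refl (toWitness (p≤q q (fromWitness q<p)))

0ℝ 1ℝ : ℝ
0ℝ = fromℚ 0ℚ
1ℝ = fromℚ 1ℚ

0≤1 : 0ℝ ≤ 1ℝ
0≤1 _ q<0 = fromWitness (ℚ.<-trans (toWitness q<0) (ℚ.positive⁻¹ 1ℚ))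

[0,1] : Set
[0,1] = Σ[ x ∈ ℝ ] 0ℝ ≤ x × x ≤ 1ℝ

[0,1]-setoid : Setoid 0ℓ 0ℓ
[0,1]-setoid = On.setoid (record { isEquivalence = ≈-isEquivalence }) (proj₁ {B = λ x → 0ℝ ≤ x × x ≤ 1ℝ})

open Setoid [0,1]-setoid using () renaming (_≈_ to _≈ᴵ_)

0ᴵ 1ᴵ : [0,1]
0ᴵ = 0ℝ , (λ _ q<0 → q<0) , 0≤1
1ᴵ = 1ℝ , 0≤1 , (λ _ q<1 → q<1)

-- The signature has one binary predicate symbol.  Only the data seen by
-- isomorphisms is recorded, not the axioms of a metric structure.

record Structure : Set₁ where
  field
    setoid    : Setoid 0ℓ 0ℓ

  open Setoid setoid public using (Carrier) renaming (_≈_ to Eq)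

  field
    distance  : Carrier → Carrier → [0,1]
    predicate : Carrier → Carrier → [0,1]

infix 4 _≅_

record _≅_ (A B : Structure) : Set where
  private
    module A = Structure A
    module B = Structure B

  field
    function   : Func A.setoid B.setoid

  open Func function public using (to)

  field
    surjective : Surjective A.Eq B.Eq to
    isometric  : ∀ x y → B.distance  (to x) (to y) ≈ᴵ A.distance  x y
    preserving : ∀ x y → B.predicate (to x) (to y) ≈ᴵ A.predicate x y

record Interval : Set where
  field
    left right : ℚ
    left≤right : left ℚ.≤ right

  length : ℚ
  length = right - left

open Interval

_∈ᴶ_ : [0,1] → Interval → Set
(x , _) ∈ᴶ J = fromℚ (left J) ≤ x × x ≤ fromℚ (right J)

-- A ⊆ ⋃ₙ Jₙ and ∑ₙ |Jₙ| ≤ t, all partial sums being ≤ t.  Restricting to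
-- rational endpoints does not change the infimum of such t.

Covered : Pred [0,1] 0ℓ → Pred ℚ 0ℓ
Covered A t =
  Σ[ J ∈ (ℕ → Interval) ]
    (∀ ω → A ω → ∃[ n ] ω ∈ᴶ J n) ×
    (∀ n → ∑[ i < n ] length (J (toℕ i)) ℚ.≤ t)

0≤covered : ∀ {A t} → Covered A t → 0ℚ ℚ.≤ t
0≤covered (_ , _ , total≤t) = total≤t 0

covered-mono : ∀ {A B t} → A ⊆ B → Covered B t → Covered A t
covered-mono A⊆B (J , covers , total≤t) = J , (λ ω ω∈A → covers ω (A⊆B ω∈A)) , total≤t

point : Interval
point = record { left = 0ℚ ; right = 0ℚ ; left≤right = ℚ.≤-refl }

points-total : ∀ n → ∑[ i < n ] length point ≡ 0ℚ
points-total ℕ.zero    = refl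
points-total (ℕ.suc n) = ≡.trans (ℚ.+-identityˡ _) (points-total n)

covered-∅ : Covered ∅ 0ℚ
covered-∅ = (λ _ → point) , (λ _ ()) , λ n → ℚ.≤-reflexive (points-total n)

covered-U : Covered U 1ℚ
covered-U = J , (λ (x , 0≤x , x≤1) _ → 0 , 0≤x , x≤1) , total≤1
  where
  J : ℕ → Interval
  J ℕ.zero    = record { left = 0ℚ ; right = 1ℚ ; left≤right = ℚ.nonNegative⁻¹ 1ℚ }
  J (ℕ.suc _) = point

  total≤1 : ∀ n → ∑[ i < n ] length (J (toℕ i)) ℚ.≤ 1ℚ
  total≤1 ℕ.zero    = ℚ.nonNegative⁻¹ 1ℚ
  total≤1 (ℕ.suc n) = ℚ.≤-reflexive (cong (1ℚ ℚ.+_) (points-total n))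

interleave : (ℕ → Interval) → (ℕ → Interval) → ℕ → Interval
interleave J K ℕ.zero    = J 0
interleave J K (ℕ.suc n) = interleave K (J ∘ ℕ.suc) n

interleaveˡ : ∀ J K n → ∃[ m ] interleave J K m ≡ J n
interleaveʳ : ∀ J K n → ∃[ m ] interleave J K m ≡ K n
interleaveˡ J K ℕ.zero    = 0 , refl
interleaveˡ J K (ℕ.suc n) = let (m , eq) = interleaveʳ K (J ∘ ℕ.suc) n in ℕ.suc m , eq
interleaveʳ J K n         = let (m , eq) = interleaveˡ K (J ∘ ℕ.suc) n in ℕ.suc m , eq

interleave-total : ∀ J K n → ∃₂ λ j k →
  ∑[ i < n ] length (interleave J K (toℕ i)) ≡
  ∑[ i < j ] length (J (toℕ i)) ℚ.+ ∑[ i < k ] length (K (toℕ i))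
interleave-total J K ℕ.zero    = 0 , 0 , refl
interleave-total J K (ℕ.suc n) =
  let (k , j , eq) = interleave-total K (J ∘ ℕ.suc) n
      s = ∑[ i < j ] length (J (ℕ.suc (toℕ i)))
      t = ∑[ i < k ] length (K (toℕ i))
  in ℕ.suc j , k ,
     ≡.trans (cong (length (J 0) ℚ.+_) (≡.trans eq (ℚ.+-comm t s)))
             (≡.sym (ℚ.+-assoc (length (J 0)) s t))

covered-∪ : ∀ {A B s t} → Covered A s → Covered B t → Covered (A ∪ B) (s ℚ.+ t)
covered-∪ {A} {B} {s} {t} (J , coversA , J≤s) (K , coversB , K≤t) = interleave J K , covers , total
  where
  covers : ∀ ω → (A ∪ B) ω → ∃[ n ] ω ∈ᴶ interleave J K n
  covers ω (inj₁ ω∈A) =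
    let (n , ω∈) = coversA ω ω∈A ; (m , eq) = interleaveˡ J K n
    in m , subst (ω ∈ᴶ_) (≡.sym eq) ω∈
  covers ω (inj₂ ω∈B) =
    let (n , ω∈) = coversB ω ω∈B ; (m , eq) = interleaveʳ J K n
    in m , subst (ω ∈ᴶ_) (≡.sym eq) ω∈

  total : ∀ n → ∑[ i < n ] length (interleave J K (toℕ i)) ℚ.≤ s ℚ.+ t
  total n =
    let (j , k , eq) = interleave-total J K n
    in subst (ℚ._≤ s ℚ.+ t) (≡.sym eq) (ℚ.+-mono-≤ (J≤s j) (K≤t k))

module Classical (lem : ExcludedMiddle 0ℓ) where

  sup : (S : Pred ℚ 0ℓ) → ∃ S → (∃[ b ] ∀ q → S q → q ℚ.≤ b) → ℝ
  sup S (s₀ , s₀∈S) (b , S≤b) = record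
    { lower     = λ q → ⌊ lem {∃[ s ] S s × q ℚ.< s} ⌋
    ; inhabited = let (q , q∈s₀) = inhabited (fromℚ s₀)
                  in q , fromWitness (s₀ , s₀∈S , toWitness q∈s₀)
    ; proper    = b , λ b∈ → let (s , s∈S , b<s) = toWitness b∈
                             in ℚ.<-irrefl refl (ℚ.<-≤-trans b<s (S≤b s s∈S))
    ; downward  = λ p<q q∈ → let (s , s∈S , q<s) = toWitness q∈
                             in fromWitness (s , s∈S , ℚ.<-trans p<q q<s)
    ; rounded   = λ q∈ → let (s , s∈S , q<s) = toWitness q∈
                             (r , q<r , r<s) = ℚ.<-dense q<s
                         in r , q<r , fromWitness (s , s∈S , r<s)
    }

  inf : (S : Pred ℚ 0ℓ) → ∃ S → (∃[ b ] ∀ q → S q → b ℚ.≤ q) → ℝ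
  inf S (s₀ , s₀∈S) (b , b≤S) =
    sup (λ l → ∀ q → S q → l ℚ.≤ q) (b , b≤S) (s₀ , λ l l≤S → l≤S s₀ s₀∈S)

  infixl 6 _+_

  _+_ : ℝ → ℝ → ℝ
  x + y =
    sup (λ s → ∃₂ λ q r → q ∈ x × r ∈ y × s ≡ q ℚ.+ r)
      (let (q , q∈x) = inhabited x ; (r , r∈y) = inhabited y
       in q ℚ.+ r , q , r , q∈x , r∈y , refl)
      (let (a , a∉x) = proper x ; (b , b∉y) = proper y
       in a ℚ.+ b , λ { _ (q , r , q∈x , r∈y , refl) →
            ℚ.<⇒≤ (ℚ.+-mono-< (∈∧∉⇒< x q∈x a∉x) (∈∧∉⇒< y r∈y b∉y)) })

  inf-lower : ∀ S s b {q} → S q → inf S s b ≤ fromℚ q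
  inf-lower S s b {q} q∈S _ p∈ =
    let (l , l≤S , p<l) = toWitness p∈ in fromWitness (ℚ.<-≤-trans p<l (l≤S q q∈S))

  inf-greatest : ∀ S s b {l} → (∀ q → S q → l ℚ.≤ q) → fromℚ l ≤ inf S s b
  inf-greatest S s b {l} l≤S _ p<l = fromWitness (l , l≤S , toWitness p<l)

  inf-approx : ∀ S s b {p q} → inf S s b ≤ fromℚ p → p ℚ.< q → ∃[ r ] S r × r ℚ.< q
  inf-approx S s b {p} {q} inf≤p p<q with lem {∃[ r ] S r × r ℚ.< q}
  ... | yes found = found
  ... | no  none  = ⊥-elim (ℚ.<-irrefl refl (toWitness (inf≤p p (fromWitness (q , q≤S , p<q)))))
    where
    q≤S : ∀ r → S r → q ℚ.≤ r
    q≤S r r∈S = ℚ.≮⇒≥ λ r<q → none (r , r∈S , r<q)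

  +-identityʳ : ∀ x → x + 0ℝ ≈ x
  +-identityʳ x = below , above
    where
    below : x + 0ℝ ≤ x
    below p p∈ with toWitness p∈
    ... | _ , (q , r , q∈x , r<0 , refl) , p<q+r =
      downward x (ℚ.<-trans p<q+r (subst (q ℚ.+ r ℚ.<_) (ℚ.+-identityʳ q)
        (ℚ.+-monoʳ-< q (toWitness {a? = r ℚ.<? 0ℚ} r<0)))) q∈x

    above : x ≤ x + 0ℝ
    above p p∈x =
      let (q , p<q , q∈x) = rounded x p∈x
          (m , p<m , m<q) = ℚ.<-dense p<q
          m-q<0 = subst (m - q ℚ.<_) (ℚ.+-inverseʳ q) (ℚ.+-monoˡ-< (ℚ.- q) m<q)
      in fromWitness (m , (q , m - q , q∈x , fromWitness m-q<0 , ≡.sym (q+[p-q]≡p m q)) , p<m)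

  +-mono : ∀ {x x′ y y′} → x ≤ x′ → y ≤ y′ → x + y ≤ x′ + y′
  +-mono x≤x′ y≤y′ _ p∈ =
    let (s , (q , r , q∈x , r∈y , s≡q+r) , p<s) = toWitness p∈
    in fromWitness (s , (q , r , x≤x′ q q∈x , y≤y′ r r∈y , s≡q+r) , p<s)

  <-cmp : Trichotomous _≈_ _<_
  <-cmp x y with lem {x < y} | lem {y < x}
  ... | yes x<y@(p , p∈y , p∉x) | _ =
    tri< x<y (λ (_ , y≤x) → p∉x (y≤x p p∈y))
         (λ (q , q∈x , q∉y) → ℚ.<-asym (∈∧∉⇒< x q∈x p∉x) (∈∧∉⇒< y p∈y q∉y))
  ... | no x≮y | yes y<x@(p , p∈x , p∉y) = tri> x≮y (λ (x≤y , _) → p∉y (x≤y p p∈x)) y<x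
  ... | no x≮y | no y≮x = tri≈ x≮y (≮⇒≥ x y y≮x , ≮⇒≥ y x x≮y) y≮x
    where
    ≮⇒≥ : ∀ x y → ¬ (y < x) → x ≤ y
    ≮⇒≥ x y y≮x q q∈x with lem {q ∈ y}
    ... | yes q∈y = q∈y
    ... | no  q∉y = ⊥-elim (y≮x (q , q∈x , q∉y))

  ℝ-strictTotalOrder : StrictTotalOrder 0ℓ 0ℓ 0ℓ
  ℝ-strictTotalOrder = record
    { Carrier = ℝ ; _≈_ = _≈_ ; _<_ = _<_
    ; isStrictTotalOrder = record
      { isStrictPartialOrder = record
        { isEquivalence = ≈-isEquivalence
        ; irrefl        = λ (_ , y≤x) (q , q∈y , q∉x) → q∉x (y≤x q q∈y)
        ; trans         = λ {_} {y} {z} (p , p∈y , p∉x) (q , q∈z , q∉y) →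
                            p , downward z (∈∧∉⇒< y p∈y q∉y) q∈z , p∉x
        ; <-resp-≈      = (λ (y≤z , _) (q , q∈y , q∉x) → q , y≤z q q∈y , q∉x)
                        , (λ (_ , z≤y) (q , q∈x , q∉y) → q , q∈x , λ q∈z → q∉y (z≤y q q∈z))
        }
      ; compare = <-cmp
      }
    }

  ℝ∖0-strictTotalOrder : StrictTotalOrder 0ℓ 0ℓ 0ℓ
  ℝ∖0-strictTotalOrder = On.strictTotalOrder ℝ-strictTotalOrder (proj₁ {B = λ x → ¬ (x ≈ 0ℝ)})

  indicator : Set → [0,1]
  indicator P = if ⌊ lem {P} ⌋ then 1ᴵ else 0ᴵ

  discrete : StrictTotalOrder 0ℓ 0ℓ 0ℓ → Structure
  discrete O = record
    { setoid    = Eq.setoid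
    ; distance  = λ x y → indicator (¬ (x O.≈ y))
    ; predicate = λ x y → indicator (x O.< y)
    }
    where
    module O = StrictTotalOrder O
    module Eq = O.Eq

  coverable : ∀ A → ∃ (Covered A)
  coverable A = 1ℚ , covered-mono {A} {U} _ covered-U

  0≤totals : ∀ A → ∃[ b ] ∀ t → Covered A t → b ℚ.≤ t
  0≤totals A = 0ℚ , λ _ → 0≤covered {A}

  λ* : Pred [0,1] 0ℓ → ℝ
  λ* A = inf (Covered A) (coverable A) (0≤totals A)

  Subset : Set
  Subset = Func [0,1]-setoid (≡.setoid Bool)

  ⟦_⟧ : Subset → Pred [0,1] 0ℓ
  ⟦ A ⟧ ω = T (Func.to A ω)

  -- Carathéodory's criterion; Lebesgue measure is λ* restricted to these sets.

  Measurable : Subset → Set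
  Measurable A = ∀ (E : Subset) → λ* ⟦ E ⟧ ≈ λ* (⟦ E ⟧ ∩ ⟦ A ⟧) + λ* (⟦ E ⟧ ∩ ∁ ⟦ A ⟧)

  AlmostEverywhere : Pred [0,1] 0ℓ → Set
  AlmostEverywhere P = λ* (∁ P) ≈ 0ℝ

  0≤λ* : ∀ A → 0ℝ ≤ λ* A
  0≤λ* A = inf-greatest (Covered A) (coverable A) (0≤totals A) (λ _ → 0≤covered {A})

  λ*≤ : ∀ {A t} → Covered A t → λ* A ≤ fromℚ t
  λ*≤ {A} = inf-lower (Covered A) (coverable A) (0≤totals A)

  λ*-mono : ∀ {A B} → A ⊆ B → λ* A ≤ λ* B
  λ*-mono {A} {B} A⊆B _ p∈ =
    let (l , l≤ , p<l) = toWitness p∈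
    in fromWitness (l , (λ t cov → l≤ t (covered-mono {A} {B} A⊆B cov)) , p<l)

  null⇒covered : ∀ {A ε} → λ* A ≤ 0ℝ → 0ℚ ℚ.< ε → ∃[ t ] Covered A t × t ℚ.< ε
  null⇒covered {A} = inf-approx (Covered A) (coverable A) (0≤totals A)

  covered⇒null : ∀ {A} → (∀ ε → 0ℚ ℚ.< ε → ∃[ t ] Covered A t × t ℚ.≤ ε) → λ* A ≈ 0ℝ
  covered⇒null {A} small = below , 0≤λ* A
    where
    below : λ* A ≤ 0ℝ
    below p p∈ with p ℚ.<? 0ℚ
    ... | yes _   = _
    ... | no  p≮0 =
      let (l , l≤ , p<l) = toWitness p∈
          (ε , p<ε , ε<l) = ℚ.<-dense p<l
          (t , cov , t≤ε) = small ε (ℚ.≤-<-trans (ℚ.≮⇒≥ p≮0) p<ε)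
      in ⊥-elim (ℚ.<-irrefl refl (ℚ.<-≤-trans ε<l (ℚ.≤-trans (l≤ t cov) t≤ε)))

  null-⊆ : ∀ {A B} → A ⊆ B → λ* B ≈ 0ℝ → λ* A ≈ 0ℝ
  null-⊆ {A} {B} A⊆B (λ*B≤0 , _) = (λ p p∈ → λ*B≤0 p (λ*-mono {A} {B} A⊆B p p∈)) , 0≤λ* A

  null-∅ : λ* ∅ ≈ 0ℝ
  null-∅ = λ*≤ {∅} covered-∅ , 0≤λ* ∅

  null-∪ : ∀ {A B} → λ* A ≈ 0ℝ → λ* B ≈ 0ℝ → λ* (A ∪ B) ≈ 0ℝ
  null-∪ {A} {B} (λ*A≤0 , _) (λ*B≤0 , _) = covered⇒null {A ∪ B} λ ε 0<ε →
    let (δ , 0<δ , δ<ε) = ℚ.<-dense 0<ε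
        0<ε-δ = subst (ℚ._< ε - δ) (ℚ.+-inverseʳ δ) (ℚ.+-monoˡ-< (ℚ.- δ) δ<ε)
        (s , covA , s<δ)   = null⇒covered {A} λ*A≤0 0<δ
        (t , covB , t<ε-δ) = null⇒covered {B} λ*B≤0 0<ε-δ
    in s ℚ.+ t , covered-∪ {A} {B} covA covB ,
       ℚ.<⇒≤ (subst (s ℚ.+ t ℚ.<_) (q+[p-q]≡p ε δ) (ℚ.+-mono-< s<δ t<ε-δ))

  measurable-U : ∀ A → U ⊆ ⟦ A ⟧ → Measurable A
  measurable-U A U⊆A E = below , above
    where
    E∩A = ⟦ E ⟧ ∩ ⟦ A ⟧
    E∖A = ⟦ E ⟧ ∩ ∁ ⟦ A ⟧

    E∖A-null : λ* E∖A ≈ 0ℝ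
    E∖A-null = null-⊆ {E∖A} {∅} (λ (_ , ω∉A) → ω∉A (U⊆A _)) null-∅

    below : λ* ⟦ E ⟧ ≤ λ* E∩A + λ* E∖A
    below p p∈ =
      +-mono {λ* E∩A} {λ* E∩A} {0ℝ} {λ* E∖A} (λ _ q∈ → q∈) (proj₂ E∖A-null) p
        (proj₂ (+-identityʳ (λ* E∩A)) p
          (λ*-mono {⟦ E ⟧} {E∩A} (λ ω∈E → ω∈E , U⊆A _) p p∈))

    above : λ* E∩A + λ* E∖A ≤ λ* ⟦ E ⟧
    above p p∈ =
      λ*-mono {E∩A} {⟦ E ⟧} proj₁ p
        (proj₁ (+-identityʳ (λ* E∩A)) p
          (+-mono {λ* E∩A} {λ* E∩A} {λ* E∖A} {0ℝ} (λ _ q∈ → q∈) (proj₁ E∖A-null) p p∈))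

  -- A finite measurable partition, given by the function that sends each
  -- point to the index of its piece; pieces may be empty.

  record Partition : Set where
    field
      size  : ℕ
      index : Func [0,1]-setoid (≡.setoid (Fin size))

    piece : Fin size → Subset
    piece i = record
      { to   = λ ω → ⌊ Func.to index ω Fin.≟ i ⌋
      ; cong = λ ω≈ω′ → cong (λ j → ⌊ j Fin.≟ i ⌋) (Func.cong index ω≈ω′)
      }

    field
      measurable : ∀ i → Measurable (piece i)

  open Partition

  trivialPartition : Partition
  trivialPartition = record
    { size       = 1
    ; index      = record { to = λ _ → Fin.zero ; cong = λ _ → refl }
    ; measurable = λ { Fin.zero → measurable-U (record { to = λ _ → true ; cong = λ _ → refl }) (λ _ → _) }
    }

  -- t is an upper estimate ∑ᵢ cᵢmᵢ, with mᵢ ≥ λ(Aᵢ), of the integral ∑ᵢ cᵢλ(Aᵢ)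
  -- of a nonnegative simple function that is ≥ u and has value cᵢ on Aᵢ.

  UpperSum : ([0,1] → [0,1]) → Pred ℚ 0ℓ
  UpperSum u t =
    Σ[ P ∈ Partition ] Σ[ c ∈ (Fin (size P) → ℚ) ] Σ[ m ∈ (Fin (size P) → ℚ) ]
      (∀ i → 0ℚ ℚ.≤ c i) ×
      (∀ i ω → ⟦ piece P i ⟧ ω → proj₁ (u ω) ≤ fromℚ (c i)) ×
      (∀ i → λ* ⟦ piece P i ⟧ ≤ fromℚ (m i)) ×
      t ≡ ∑[ i < size P ] (c i * m i)

  0≤UpperSum : ∀ {u t} → UpperSum u t → 0ℚ ℚ.≤ t
  0≤UpperSum (P , c , m , 0≤c , _ , λ*≤m , refl) = 0≤∑ (size P) λ i →
    0≤* (0≤c i) (fromℚ-cancel-≤ (λ q q<0 → λ*≤m i q (0≤λ* ⟦ piece P i ⟧ q q<0)))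

  UpperSum-1 : ∀ u → UpperSum u 1ℚ
  UpperSum-1 u =
    trivialPartition , (λ _ → 1ℚ) , (λ _ → 1ℚ) ,
    (λ _ → ℚ.nonNegative⁻¹ 1ℚ) ,
    (λ _ ω _ → proj₂ (proj₂ (u ω))) ,
    (λ i → let A = ⟦ piece trivialPartition i ⟧ in λ*≤ {A} (covered-mono {A} {U} _ covered-U)) ,
    refl

  -- The Lebesgue integral of a bounded measurable function u is the infimum
  -- of the integrals of the simple functions above u.  In L¹ below it is only
  -- applied to measurable u.

  ∫ : ([0,1] → [0,1]) → [0,1]
  ∫ u = inf (UpperSum u) nonempty bounded
      , inf-greatest (UpperSum u) nonempty bounded (λ _ → 0≤UpperSum {u})
      , inf-lower (UpperSum u) nonempty bounded (UpperSum-1 u)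
    where
    nonempty : ∃ (UpperSum u)
    nonempty = 1ℚ , UpperSum-1 u

    bounded : ∃[ b ] ∀ t → UpperSum u t → b ℚ.≤ t
    bounded = 0ℚ , λ _ → 0≤UpperSum {u}

  module _ (M : Structure) where
    open Structure M

    Section : Set
    Section = Func [0,1]-setoid setoid

    Simple : Section → Set
    Simple s = Σ[ P ∈ Partition ]
      ∀ i {ω ω′} → ⟦ piece P i ⟧ ω → ⟦ piece P i ⟧ ω′ → Eq (Func.to s ω) (Func.to s ω′)

    ConvergesTo : (ℕ → Carrier) → Carrier → Set
    ConvergesTo x y =
      ∀ ε → 0ℚ ℚ.< ε → ∃[ N ] ∀ n → N ℕ.≤ n → proj₁ (distance (x n) y) < fromℚ ε

    MeasurableSection : Section → Set
    MeasurableSection f = Σ[ s ∈ (ℕ → Section) ]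
      (∀ n → Simple (s n)) ×
      AlmostEverywhere (λ ω → ConvergesTo (λ n → Func.to (s n) ω) (Func.to f ω))

    AgreeAt DisagreeAt : Section → Section → Pred [0,1] 0ℓ
    AgreeAt f g ω = Eq (Func.to f ω) (Func.to g ω)
    DisagreeAt f g = ∁ (AgreeAt f g)

    L¹-setoid : Setoid 0ℓ 0ℓ
    L¹-setoid = record
      { Carrier       = ∃ MeasurableSection
      ; _≈_           = λ (f , _) (g , _) → AlmostEverywhere (AgreeAt f g)
      ; isEquivalence = record
        { refl  = λ {(f , _)} → null-⊆ {DisagreeAt f f} {∅} (λ f≉f → f≉f M.refl) null-∅
        ; sym   = λ {(f , _)} {(g , _)} →
            null-⊆ {DisagreeAt g f} {DisagreeAt f g} (λ g≉f f≈g → g≉f (M.sym f≈g))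
        ; trans = λ {(f , _)} {(g , _)} {(h , _)} f≈g g≈h →
            null-⊆ {DisagreeAt f h} {DisagreeAt f g ∪ DisagreeAt g h} (disagree f g h)
              (null-∪ {DisagreeAt f g} {DisagreeAt g h} f≈g g≈h)
        }
      }
      where
      module M = Setoid setoid

      disagree : ∀ f g h → DisagreeAt f h ⊆ DisagreeAt f g ∪ DisagreeAt g h
      disagree f g h {ω} f≉h with lem {AgreeAt f g ω}
      ... | yes f≈g = inj₂ (λ g≈h → f≉h (M.trans f≈g g≈h))
      ... | no  f≉g = inj₁ f≉g

    L¹ : Structure
    L¹ = record
      { setoid    = L¹-setoid
      ; distance  = λ (f , _) (g , _) → ∫ λ ω → distance  (Func.to f ω) (Func.to g ω)
      ; predicate = λ (f , _) (g , _) → ∫ λ ω → predicate (Func.to f ω) (Func.to g ω)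
      }

{-# OPTIONS --safe #-}

-- A measurable section takes countably many values almost everywhere, so an
-- isomorphism of the L¹ spaces can be induced by order isomorphisms
-- φ_ω : ℝ∖{p_ω} → ℝ∖{0} as long as every real number equals p_ω with probability
-- 0 and φ_ω(x) depends on finitely many binary digits of ω for each x ≠ p_ω.
-- Such φ_ω are infinite compositions: the n-th binary digit of ω decides whether
-- to apply an automorphism of ℝ that is the identity outside ]−2⁻ⁿ,2⁻ⁿ] and moves
-- ]−2⁻ⁿ⁻¹,2⁻ⁿ⁻¹] off itself.  A point that has left one of these intervals does not
-- move any more, and at every stage at most one value of the digit keeps a given
-- point inside, so the ω with p_ω = x lie in one dyadic interval of length 2⁻ⁿ for
-- every n.  Conversely, y ≠ 0 lies outside some ]−2⁻ⁿ,2⁻ⁿ], and the inverse of the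
-- composition of the first n automorphisms sends it to φ_ω⁻¹(y).

module Submission where

open import Axiom.ExcludedMiddle using (ExcludedMiddle)
open import Data.Bool using (Bool; true; false; T)
open import Data.Bool.Properties using (T?; T-≡; ⇔→≡)
open import Data.Empty using (⊥-elim)
open import Data.Fin as Fin using (Fin; toℕ)
import Data.Fin.Properties as Fin
open import Data.Integer as ℤ using (+_; -[1+_])
import Data.Integer.Properties as ℤ
open import Data.Nat as ℕ using (ℕ)
import Data.Nat.Properties as ℕ
open import Data.Product using (∃; ∃₂; Σ-syntax; ∃-syntax; _×_; _,_; proj₁; proj₂; map₂)
open import Data.Rational as ℚ using (ℚ; 0ℚ; 1ℚ; ½; _*_; _-_; mkℚ)
import Data.Rational.Properties as ℚ
open import Data.Rational.Solver using (module +-*-Solver)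
import Data.Rational.Unnormalised as ℚᵘ
import Data.Rational.Unnormalised.Properties as ℚᵘ
open import Data.Sum using (inj₁; inj₂)
open import Data.Vec using (Vec; []; _∷_; replicate)
open import Function using (_∘_; Func; Equivalence; Inverse; _⇔_; mk⇔)
open import Function.Related.TypeIsomorphisms using (¬-cong-⇔)
open import Level using (0ℓ)
open import Relation.Binary using (tri<; tri≈; tri>; IsEquivalence; Setoid; StrictTotalOrder)
open import Relation.Binary.PropositionalEquality as ≡ using (_≡_; refl; sym; trans; cong; cong₂; subst; subst₂)
open import Relation.Nullary using (¬_; Dec; yes; no; ¬?; _×-dec_)
open import Relation.Nullary.Decidable using (⌊_⌋; toWitness; fromWitness; decidable-stable)
open import Relation.Unary using (Pred; _∩_; _∪_; ∁; ∅; _⊆_)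
open import Algebra.Properties.Monoid.Sum ℚ.+-0-monoid using (sum-syntax; sum-cong-≗)
open import Algebra.Properties.CommutativeMonoid.Sum ℚ.+-0-commutativeMonoid using (∑-distrib-+)
open import Defs

open ℝ
open Interval
open +-*-Solver using (solve; _:+_; _:*_; _:-_; _:=_; con)
open IsEquivalence ≈-isEquivalence using () renaming (refl to ≈-refl; sym to ≈-sym; trans to ≈-trans)
open Setoid [0,1]-setoid using () renaming (_≈_ to _≈ᴵ_; sym to ≈ᴵ-sym)

-- Rational arithmetic

½^_ : ℕ → ℚ
½^ ℕ.zero  = 1ℚ
½^ ℕ.suc n = ½ * ½^ n

0≤½^ : ∀ n → 0ℚ ℚ.≤ ½^ n
0≤½^ ℕ.zero    = ℚ.nonNegative⁻¹ 1ℚ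
0≤½^ (ℕ.suc n) = 0≤* (ℚ.nonNegative⁻¹ ½) (0≤½^ n)

½-halves : ∀ q → ½ * q ℚ.+ ½ * q ≡ q
½-halves = solve 1 (λ q → con ½ :* q :+ con ½ :* q := q) refl

½*≤ : ∀ {q} → 0ℚ ℚ.≤ q → ½ * q ℚ.≤ q
½*≤ {q} 0≤q = subst (½ * q ℚ.≤_) (½-halves q)
  (subst (ℚ._≤ ½ * q ℚ.+ ½ * q) (ℚ.+-identityʳ (½ * q))
    (ℚ.+-monoʳ-≤ (½ * q) (0≤* (ℚ.nonNegative⁻¹ ½) 0≤q)))

½^≤1 : ∀ n → ½^ n ℚ.≤ 1ℚ
½^≤1 ℕ.zero    = ℚ.≤-refl
½^≤1 (ℕ.suc n) = ℚ.≤-trans (½*≤ (0≤½^ n)) (½^≤1 n)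

-- The first term is half of the bound. The other terms form the same kind of sum with `N` increased
-- by one, which by induction is at most the other half.
∑½^ : ∀ N n → ∑[ i < n ] (½^ ℕ.suc (N ℕ.+ toℕ i)) ℚ.≤ ½^ N
∑½^ N ℕ.zero    = 0≤½^ N
∑½^ N (ℕ.suc n) = begin
  ½^ ℕ.suc (N ℕ.+ 0) ℚ.+ ∑[ i < n ] (½^ ℕ.suc (N ℕ.+ ℕ.suc (toℕ i)))
    ≡⟨ cong₂ ℚ._+_ (cong (λ k → ½^ ℕ.suc k) (ℕ.+-identityʳ N))
                   (sum-cong-≗ {n} (λ i → cong (λ k → ½^ ℕ.suc k) (ℕ.+-suc N (toℕ i)))) ⟩
  ½^ ℕ.suc N ℚ.+ ∑[ i < n ] (½^ ℕ.suc (ℕ.suc N ℕ.+ toℕ i))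
    ≤⟨ ℚ.+-monoʳ-≤ (½^ ℕ.suc N) (∑½^ (ℕ.suc N) n) ⟩
  ½ * ½^ N ℚ.+ ½ * ½^ N
    ≡⟨ ½-halves (½^ N) ⟩
  ½^ N ∎
  where open ℚ.≤-Reasoning

fromℕ : ℕ → ℚ
fromℕ ℕ.zero    = 0ℚ
fromℕ (ℕ.suc n) = 1ℚ ℚ.+ fromℕ n

toℚᵘ-fromℕ : ∀ n → ℚ.toℚᵘ (fromℕ n) ℚᵘ.≃ ℚᵘ.mkℚᵘ (+ n) 0
toℚᵘ-fromℕ ℕ.zero    = ℚᵘ.≃-refl
toℚᵘ-fromℕ (ℕ.suc n) = ℚᵘ.≃-trans (ℚ.toℚᵘ-homo-+ 1ℚ (fromℕ n))
  (ℚᵘ.≃-trans (ℚᵘ.+-congʳ ℚᵘ.1ℚᵘ (toℚᵘ-fromℕ n))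
    (ℚᵘ.*≡* (cong (ℤ._* + 1) (cong (λ k → + 1 ℤ.+ k) (ℤ.*-identityʳ (+ n))))))

≤-fromℕ : ∀ q → ∃[ n ] q ℚ.≤ fromℕ n
-- The numerator is large enough because the denominator, `d` plus one, is at least 1.
≤-fromℕ q@(mkℚ (+ n) d _) = n , ℚ.toℚᵘ-cancel-≤
  (ℚᵘ.≤-trans (ℚᵘ.*≤* (ℤ.*-monoˡ-≤-nonNeg (+ n) (ℤ.+≤+ (ℕ.s≤s ℕ.z≤n))))
              (ℚᵘ.≤-reflexive (ℚᵘ.≃-sym (toℚᵘ-fromℕ n))))
≤-fromℕ q@(mkℚ -[1+ _ ] _ _) = 0 , ℚ.<⇒≤ (ℚ.negative⁻¹ q)

½^*fromℕ≤1 : ∀ n → ½^ n * fromℕ n ℚ.≤ 1ℚ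
½^*fromℕ≤1 ℕ.zero    = ℚ.nonNegative⁻¹ 1ℚ
½^*fromℕ≤1 (ℕ.suc n) = subst (ℚ._≤ 1ℚ)
  (solve 2 (λ h k → con ½ :* h :+ con ½ :* (h :* k) := con ½ :* h :* (con 1ℚ :+ k)) refl (½^ n) (fromℕ n))
  (ℚ.+-mono-≤ (ℚ.*-monoˡ-≤-nonNeg ½ (½^≤1 n)) (ℚ.*-monoˡ-≤-nonNeg ½ (½^*fromℕ≤1 n)))

-- The exponent is a natural number at or above `q` divided by `δ`, and `½^ n` times that number is
-- at most 1.
archimedean : ∀ q {δ} → 0ℚ ℚ.< δ → ∃[ n ] ½^ n * q ℚ.≤ δ
archimedean q {δ} 0<δ = n , (begin
  ½^ n * q                ≡⟨ cong (½^ n *_) q≡δ*r ⟩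
  ½^ n * (δ * r)          ≤⟨ ℚ.*-monoˡ-≤-nonNeg (½^ n) (ℚ.*-monoˡ-≤-nonNeg δ r≤n) ⟩
  ½^ n * (δ * fromℕ n)    ≡⟨ solve 3 (λ h δ k → h :* (δ :* k) := δ :* (h :* k)) refl (½^ n) δ (fromℕ n) ⟩
  δ * (½^ n * fromℕ n)    ≤⟨ ℚ.*-monoˡ-≤-nonNeg δ (½^*fromℕ≤1 n) ⟩
  δ * 1ℚ                  ≡⟨ ℚ.*-identityʳ δ ⟩
  δ                       ∎)
  where
  open ℚ.≤-Reasoning
  instance
    δ≢0 : ℚ.NonZero δ
    δ≢0 = ℚ.>-nonZero 0<δ
    0≤δ : ℚ.NonNegative δ
    0≤δ = ℚ.nonNegative (ℚ.<⇒≤ 0<δ)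
  r = (ℚ.1/ δ) * q
  n = proj₁ (≤-fromℕ r)
  instance
    0≤½^n : ℚ.NonNegative (½^ n)
    0≤½^n = ℚ.nonNegative (0≤½^ n)
  r≤n = proj₂ (≤-fromℕ r)
  q≡δ*r : q ≡ δ * r
  q≡δ*r = trans (sym (ℚ.*-identityˡ q))
    (trans (cong (_* q) (sym (ℚ.*-inverseʳ δ))) (ℚ.*-assoc δ (ℚ.1/ δ) q))

∑-mono-≤ : ∀ n {s t : Fin n → ℚ} → (∀ i → s i ℚ.≤ t i) → ∑[ i < n ] s i ℚ.≤ ∑[ i < n ] t i
∑-mono-≤ ℕ.zero    s≤t = ℚ.≤-refl
∑-mono-≤ (ℕ.suc n) s≤t = ℚ.+-mono-≤ (s≤t Fin.zero) (∑-mono-≤ n (s≤t ∘ Fin.suc))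

p<q⇒0<q-p : ∀ {p q} → p ℚ.< q → 0ℚ ℚ.< q - p
p<q⇒0<q-p {p} {q} p<q = subst (ℚ._< q - p) (ℚ.+-inverseʳ p) (ℚ.+-monoˡ-< (ℚ.- p) p<q)

p-δ<p : ∀ p {δ} → 0ℚ ℚ.< δ → p - δ ℚ.< p
p-δ<p p {δ} 0<δ = subst (p - δ ℚ.<_) (ℚ.+-identityʳ p) (ℚ.+-monoʳ-< p (ℚ.neg-antimono-< 0<δ))

eighth : ℚ → ℚ
eighth q = ½ * (½ * (½ * q))

0<eighth : ∀ {q} → 0ℚ ℚ.< q → 0ℚ ℚ.< eighth q
0<eighth 0<q = 0<½* (0<½* (0<½* 0<q))
  where
  0<½* : ∀ {q} → 0ℚ ℚ.< q → 0ℚ ℚ.< ½ * q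
  0<½* {q} 0<q = subst (ℚ._< ½ * q) (ℚ.*-zeroʳ ½) (ℚ.*-monoʳ-<-pos ½ 0<q)

-- Four eighths of `l - p` are half of the gap, so the sum stays above `p`. Each summand loses two
-- of them: one to pass from an almost minimal member to a lower bound, one to get strictly below
-- that bound.
<-minus-eighths : ∀ {p l} q r → p ℚ.< l → l ℚ.≤ q ℚ.+ r →
                  let δ = eighth (l - p) in p ℚ.< (q - δ - δ) ℚ.+ (r - δ - δ)
<-minus-eighths {p} {l} q r p<l l≤q+r = begin-strict
  p                                 ≡⟨ ½-halves p ⟨
  ½ * p ℚ.+ ½ * p                   <⟨ ℚ.+-monoʳ-< (½ * p) (ℚ.*-monoʳ-<-pos ½ p<l) ⟩
  ½ * p ℚ.+ ½ * l                   ≡⟨ solve 2 (λ p l → con ½ :* p :+ con ½ :* l := l :- con ½ :* (l :- p)) refl p l ⟩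
  l - ½ * (l - p)                   ≤⟨ ℚ.+-monoˡ-≤ (ℚ.- (½ * (l - p))) l≤q+r ⟩
  q ℚ.+ r - ½ * (l - p)             ≡⟨ four-eighths (l - p) ⟩
  (q - eighth (l - p) - eighth (l - p)) ℚ.+ (r - eighth (l - p) - eighth (l - p)) ∎
  where
  open ℚ.≤-Reasoning
  four-eighths : ∀ d → q ℚ.+ r - ½ * d ≡ (q - eighth d - eighth d) ℚ.+ (r - eighth d - eighth d)
  four-eighths = solve 3 (λ q r d → let e = con ½ :* (con ½ :* (con ½ :* d)) in
    q :+ r :- con ½ :* d := (q :- e :- e) :+ (r :- e :- e)) refl q r

-- Automorphisms of (ℚ, <) and their action on ℝ

fromℚ-mono-< : ∀ {p q} → p ℚ.< q → fromℚ p < fromℚ q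
fromℚ-mono-< {p} p<q = p , fromWitness p<q , λ p<p → ℚ.<-irrefl refl (toWitness p<p)

<-dense : ∀ {x y} → x < y → ∃[ z ] x < z × z < y
<-dense {x} {y} (q , q∈y , q∉x) =
  let (r , q<r , r∈y) = rounded y q∈y
  in fromℚ r , (q , fromWitness q<r , q∉x) , (r , r∈y , λ r<r → ℚ.<-irrefl refl (toWitness r<r))

-- Automorphisms of the rationals suffice, since they act on cuts by precomposition. Totality of the
-- order yields monotonicity of `from` and the second inverse law.
record Automorphism : Set where
  field
    to from : ℚ → ℚ
    to-mono : ∀ {p q} → p ℚ.< q → to p ℚ.< to q
    to∘from : ∀ q → to (from q) ≡ q

  to-mono-≤ : ∀ {p q} → p ℚ.≤ q → to p ℚ.≤ to q
  to-mono-≤ {p} {q} p≤q with ℚ.<-cmp p q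
  ... | tri< p<q _    _   = ℚ.<⇒≤ (to-mono p<q)
  ... | tri≈ _   refl _   = ℚ.≤-refl
  ... | tri> _   _    q<p = ⊥-elim (ℚ.<-irrefl refl (ℚ.<-≤-trans q<p p≤q))

  from-mono : ∀ {p q} → p ℚ.< q → from p ℚ.< from q
  from-mono {p} {q} p<q = ℚ.≰⇒> λ q≤p →
    ℚ.<-irrefl refl (ℚ.<-≤-trans p<q (subst₂ ℚ._≤_ (to∘from q) (to∘from p) (to-mono-≤ q≤p)))

  from∘to : ∀ q → from (to q) ≡ q
  from∘to q with ℚ.<-cmp (from (to q)) q
  ... | tri< lt _  _  = ⊥-elim (ℚ.<-irrefl (to∘from (to q)) (to-mono lt))
  ... | tri≈ _  eq _  = eq
  ... | tri> _  _  gt = ⊥-elim (ℚ.<-irrefl (sym (to∘from (to q))) (to-mono gt))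

open Automorphism

identity : Automorphism
identity = record { to = λ q → q ; from = λ q → q ; to-mono = λ p<q → p<q ; to∘from = λ _ → refl }

inverse : Automorphism → Automorphism
inverse f = record { to = from f ; from = to f ; to-mono = from-mono f ; to∘from = from∘to f }

infixr 9 _∙_

_∙_ : Automorphism → Automorphism → Automorphism
f ∙ g = record
  { to      = to f ∘ to g
  ; from    = from g ∘ from f
  ; to-mono = to-mono f ∘ to-mono g
  ; to∘from = λ q → trans (cong (to f) (to∘from g (from f q))) (to∘from f q)
  }

-- The inverse of a pointwise maximum of increasing bijections is the pointwise minimum of their
-- inverses. Minima are therefore available as inverses of joins of inverses.
join : Automorphism → Automorphism → Automorphism
join f g = record { to = h ; from = k ; to-mono = h-mono ; to∘from = h∘k }
  where
  h k : ℚ → ℚ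
  h q = to f q ℚ.⊔ to g q
  k q = from f q ℚ.⊓ from g q

  h-mono : ∀ {p q} → p ℚ.< q → h p ℚ.< h q
  h-mono {p} {q} p<q with ℚ.⊔-sel (to f p) (to g p)
  ... | inj₁ eq = subst (ℚ._< h q) (sym eq) (ℚ.<-≤-trans (to-mono f p<q) (ℚ.p≤p⊔q (to f q) (to g q)))
  ... | inj₂ eq = subst (ℚ._< h q) (sym eq) (ℚ.<-≤-trans (to-mono g p<q) (ℚ.p≤q⊔p (to f q) (to g q)))

  h∘k : ∀ q → h (k q) ≡ q
  h∘k q with ℚ.≤-total (from f q) (from g q)
  ... | inj₁ f≤g = trans (cong h (ℚ.p≤q⇒p⊓q≡p f≤g)) (trans (ℚ.p≥q⇒p⊔q≡p
    (subst (to g (from f q) ℚ.≤_) (trans (to∘from g q) (sym (to∘from f q))) (to-mono-≤ g f≤g))) (to∘from f q))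
  ... | inj₂ g≤f = trans (cong h (ℚ.p≥q⇒p⊓q≡q g≤f)) (trans (ℚ.p≤q⇒p⊔q≡q
    (subst (to f (from g q) ℚ.≤_) (trans (to∘from f q) (sym (to∘from g q))) (to-mono-≤ f g≤f))) (to∘from g q))

shift : ℚ → Automorphism
shift c = record
  { to      = ℚ._+ c
  ; from    = _- c
  ; to-mono = ℚ.+-monoˡ-< c
  ; to∘from = λ q → solve 2 (λ q c → q :- c :+ c := q) refl q c
  }

scale : ∀ k .{{_ : ℚ.Positive k}} → Automorphism
scale k = record
  { to      = k *_
  ; from    = k⁻¹ *_
  ; to-mono = ℚ.*-monoʳ-<-pos k
  ; to∘from = λ q → trans (sym (ℚ.*-assoc k k⁻¹ q))
                      (trans (cong (_* q) (ℚ.*-inverseʳ k)) (ℚ.*-identityˡ q))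
  }
  where
  instance
    k≢0 : ℚ.NonZero k
    k≢0 = ℚ.pos⇒nonZero k
  k⁻¹ = ℚ.1/ k

2ℚ 3ℚ : ℚ
2ℚ = 1ℚ ℚ.+ 1ℚ
3ℚ = 2ℚ ℚ.+ 1ℚ

-- from squeeze q = max q (min (3 q + 2) ((q + 2) / 3)) moves only the points
-- between −1 and 1, and sends −½ to ½.

squeeze : Automorphism
squeeze = inverse (join identity (inverse (join (inverse (shift 2ℚ ∙ scale 3ℚ)) (shift (ℚ.- 2ℚ) ∙ scale 3ℚ))))

squeeze-1 : from squeeze 1ℚ ≡ 1ℚ
squeeze-1 = refl

≤-squeeze : ∀ q → q ℚ.≤ from squeeze q
≤-squeeze q = ℚ.p≤p⊔q q _

squeeze-fixes-≤ : ∀ {q} → q ℚ.≤ ℚ.- 1ℚ → from squeeze q ≡ q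
squeeze-fixes-≤ {q} q≤-1 = ℚ.p≥q⇒p⊔q≡p (ℚ.≤-trans (ℚ.p⊓q≤p (3ℚ * q ℚ.+ 2ℚ) _) (begin
  3ℚ * q ℚ.+ 2ℚ           ≡⟨ solve 1 (λ q → con 3ℚ :* q :+ con 2ℚ := q :+ con 2ℚ :* (q :+ con 1ℚ)) refl q ⟩
  q ℚ.+ 2ℚ * (q ℚ.+ 1ℚ)   ≤⟨ ℚ.+-monoʳ-≤ q (ℚ.*-monoˡ-≤-nonNeg 2ℚ (ℚ.+-monoˡ-≤ 1ℚ q≤-1)) ⟩
  q ℚ.+ 0ℚ                ≡⟨ ℚ.+-identityʳ q ⟩
  q                       ∎))
  where open ℚ.≤-Reasoning

squeeze-fixes-≥ : ∀ {q} → 1ℚ ℚ.≤ q → from squeeze q ≡ q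
squeeze-fixes-≥ {q} 1≤q = ℚ.p≥q⇒p⊔q≡p (ℚ.≤-trans (ℚ.p⊓q≤q (3ℚ * q ℚ.+ 2ℚ) (⅓ * (q - ℚ.- 2ℚ))) (begin
  ⅓ * (q - ℚ.- 2ℚ)        ≡⟨ solve 1 (λ q → con ⅓ :* (q :- con (ℚ.- 2ℚ)) := con ⅓ :* (q :+ con 2ℚ :* con 1ℚ)) refl q ⟩
  ⅓ * (q ℚ.+ 2ℚ * 1ℚ)     ≤⟨ ℚ.*-monoˡ-≤-nonNeg ⅓ (ℚ.+-monoʳ-≤ q (ℚ.*-monoˡ-≤-nonNeg 2ℚ 1≤q)) ⟩
  ⅓ * (q ℚ.+ 2ℚ * q)      ≡⟨ solve 1 (λ q → con ⅓ :* (q :+ con 2ℚ :* q) := q) refl q ⟩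
  q                       ∎))
  where
  open ℚ.≤-Reasoning
  ⅓ = ℚ.1/ 3ℚ

infixr 8 _·_

-- This is the continuous extension of `f` applied to `x`: a rational q lies below the image iff
-- `from f q` lies below `x`.
_·_ : Automorphism → ℝ → ℝ
f · x = record
  { lower     = lower x ∘ from f
  ; inhabited = let (q , q∈x) = inhabited x in to f q , subst (_∈ x) (sym (from∘to f q)) q∈x
  ; proper    = let (q , q∉x) = proper x in to f q , q∉x ∘ subst (_∈ x) (from∘to f q)
  ; downward  = downward x ∘ from-mono f
  ; rounded   = λ {q} q∈ →
      let (r , q<r , r∈x) = rounded x q∈
      in to f r , subst (ℚ._< to f r) (to∘from f q) (to-mono f q<r) , subst (_∈ x) (sym (from∘to f r)) r∈x
  }

·-cong : ∀ f {x y} → x ≈ y → f · x ≈ f · y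
·-cong f (x≤y , y≤x) = (x≤y ∘ from f) , (y≤x ∘ from f)

·-mono-< : ∀ f {x y} → x < y → f · x < f · y
·-mono-< f {x} {y} (q , q∈y , q∉x) =
  to f q , subst (_∈ y) (sym (from∘to f q)) q∈y , q∉x ∘ subst (_∈ x) (from∘to f q)

inverseˡ : ∀ f x → inverse f · f · x ≈ x
inverseˡ f x = (λ q → subst (_∈ x) (from∘to f q)) , (λ q → subst (_∈ x) (sym (from∘to f q)))

inverseʳ : ∀ f x → f · inverse f · x ≈ x
inverseʳ f x = (λ q → subst (_∈ x) (to∘from f q)) , (λ q → subst (_∈ x) (sym (to∘from f q)))

·-cancel-≤ : ∀ f {x y} → f · x ≤ f · y → x ≤ y
·-cancel-≤ f {x} {y} fx≤fy q = subst (λ q → q ∈ x → q ∈ y) (from∘to f q) (fx≤fy (to f q))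

·-cancel-< : ∀ f {x y} → f · x < f · y → x < y
·-cancel-< f (q , q∈ , q∉) = from f q , q∈ , q∉

-- −1 < x ≤ 1, since q ∈ x means q < x.

Inside : ℝ → Set
Inside x = ℚ.- 1ℚ ∈ x × ¬ 1ℚ ∈ x

inside-resp-≈ : ∀ {x y} → x ≈ y → Inside x → Inside y
inside-resp-≈ (x≤y , y≤x) (-1∈x , 1∉x) = x≤y _ -1∈x , 1∉x ∘ y≤x _

inside-double : ∀ x → Inside (scale 2ℚ · x) → Inside x
inside-double x (-½∈x , ½∉x) =
  downward x (toWitness {a? = ℚ.- 1ℚ ℚ.<? ℚ.- ½} _) -½∈x ,
  ½∉x ∘ downward x (toWitness {a? = ½ ℚ.<? 1ℚ} _)

-- As `from squeeze` never lowers a rational, one inclusion holds for every cut. The other one rests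
-- on the fixed rationals at or below -1 and at or above 1.
squeeze-fixes : ∀ x → ¬ Inside x → squeeze · x ≈ x
squeeze-fixes x outside = squeezed≤ , ≤squeezed
  where
  squeezed≤ : squeeze · x ≤ x
  squeezed≤ q βq∈x with ℚ.<-cmp q (from squeeze q)
  ... | tri< q<βq _ _ = downward x q<βq βq∈x
  ... | tri≈ _ eq _   = subst (_∈ x) (sym eq) βq∈x
  ... | tri> _ _ βq<q = ⊥-elim (ℚ.<-irrefl refl (ℚ.<-≤-trans βq<q (≤-squeeze q)))

  ≤squeezed : x ≤ squeeze · x
  ≤squeezed q q∈x with ℚ.≤-total 1ℚ q | T? (lower x (ℚ.- 1ℚ)) | T? (lower x 1ℚ)
  ... | inj₁ 1≤q | _        | _       = subst (_∈ x) (sym (squeeze-fixes-≥ 1≤q)) q∈x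
  ... | inj₂ _   | no -1∉x  | _       = subst (_∈ x) (sym (squeeze-fixes-≤ (ℚ.<⇒≤ (∈∧∉⇒< x q∈x -1∉x)))) q∈x
  ... | inj₂ _   | yes -1∈x | no 1∉x  = ⊥-elim (outside (-1∈x , 1∉x))
  ... | inj₂ q≤1 | yes _    | yes 1∈x with ℚ.<-cmp q 1ℚ
  -- The image of `q` stays below the fixed point 1, which belongs to `x`.
  ...   | tri< q<1 _ _  = downward x (subst (from squeeze q ℚ.<_) squeeze-1 (from-mono squeeze q<1)) 1∈x
  ...   | tri≈ _ refl _ = q∈x
  ...   | tri> _ _ 1<q  = ⊥-elim (ℚ.<-irrefl refl (ℚ.<-≤-trans 1<q q≤1))

-- Because `from squeeze` sends -½ to ½, lying above -½ after squeezing computes to lying above ½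
-- before it.
squeeze-moves : ∀ x → Inside (scale 2ℚ · x) → ¬ Inside (scale 2ℚ · squeeze · x)
squeeze-moves x (_ , ½∉x) (½∈x , _) = ½∉x ½∈x

-- The random gap

zoom : ℕ → Automorphism
zoom ℕ.zero    = identity
zoom (ℕ.suc n) = scale 2ℚ ∙ zoom n

from-zoom : ∀ n q → from (zoom n) q ≡ ½^ n * q
from-zoom ℕ.zero    q = sym (ℚ.*-identityˡ q)
from-zoom (ℕ.suc n) q = trans (from-zoom n (½ * q))
  (solve 2 (λ h q → h :* (con ½ :* q) := con ½ :* h :* q) refl (½^ n) q)

-- By `from-zoom` this is the condition -2⁻ⁿ < x ≤ 2⁻ⁿ.
Near : ℕ → ℝ → Set
Near n x = Inside (zoom n · x)

near? : ∀ n x → Dec (Near n x)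
near? n x = T? _ ×-dec ¬? (T? _)

near-resp-≈ : ∀ n {x y} → x ≈ y → Near n x → Near n y
near-resp-≈ n {x} {y} x≈y = inside-resp-≈ {zoom n · x} {zoom n · y} (·-cong (zoom n) {x} {y} x≈y)

near-pred : ∀ n x → Near (ℕ.suc n) x → Near n x
near-pred n x = inside-double (zoom n · x)

0<½^ : ∀ n → 0ℚ ℚ.< ½^ n
0<½^ ℕ.zero    = ℚ.positive⁻¹ 1ℚ
0<½^ (ℕ.suc n) = subst (ℚ._< ½ * ½^ n) (ℚ.*-zeroʳ ½) (ℚ.*-monoʳ-<-pos ½ (0<½^ n))

near-0 : ∀ n → Near n 0ℝ
near-0 n =
  fromWitness (subst (ℚ._< 0ℚ) (sym (from-zoom n (ℚ.- 1ℚ)))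
    (subst (½^ n * ℚ.- 1ℚ ℚ.<_) (ℚ.*-zeroʳ (½^ n)) (ℚ.*-monoʳ-<-pos (½^ n) {{ℚ.positive (0<½^ n)}} (ℚ.negative⁻¹ (ℚ.- 1ℚ))))) ,
  λ 1∈ → ℚ.<-asym (0<½^ n) (subst (ℚ._< 0ℚ) (trans (from-zoom n 1ℚ) (ℚ.*-identityʳ (½^ n))) (toWitness 1∈))

>0⇒far : ∀ {x} → 0ℝ < x → ∃[ n ] ¬ Near n x
>0⇒far {x} (r , r∈x , r≮0) =
  -- Only 0 ≤ `r` is known; a strictly positive member is needed to fit some 2⁻ⁿ below it.
  let (s , r<s , s∈x) = rounded x r∈x
      (n , h≤s) = archimedean 1ℚ (ℚ.≤-<-trans (ℚ.≮⇒≥ (r≮0 ∘ fromWitness)) r<s)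
  in n , λ (_ , h∉x) → ℚ.<-irrefl refl (ℚ.<-≤-trans (∈∧∉⇒< x s∈x (h∉x ∘ subst (_∈ x) (sym (from-zoom n 1ℚ)))) h≤s)

<0⇒far : ∀ {x} → x < 0ℝ → ∃[ n ] ¬ Near n x
<0⇒far {x} (r , r∈0 , r∉x) =
  let (n , h≤-r) = archimedean 1ℚ (ℚ.neg-antimono-< (toWitness r∈0))
  in n , λ (-h∈x , _) → ℚ.<-irrefl refl (ℚ.<-≤-trans (∈∧∉⇒< x -h∈x r∉x) (begin
    r                      ≡⟨ solve 1 (λ r → r := con 0ℚ :- (con 0ℚ :- r)) refl r ⟩
    0ℚ - (0ℚ - r)          ≡⟨ cong (0ℚ -_) (ℚ.+-identityˡ (ℚ.- r)) ⟩
    0ℚ - (ℚ.- r)           ≤⟨ ℚ.+-monoʳ-≤ 0ℚ (ℚ.neg-antimono-≤ h≤-r) ⟩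
    0ℚ - ½^ n * 1ℚ         ≡⟨ solve 1 (λ h → con 0ℚ :- h :* con 1ℚ := h :* con (ℚ.- 1ℚ)) refl (½^ n) ⟩
    ½^ n * ℚ.- 1ℚ          ≡⟨ from-zoom n (ℚ.- 1ℚ) ⟨
    from (zoom n) (ℚ.- 1ℚ) ∎))
  where open ℚ.≤-Reasoning

-- Conjugation by `zoom n` carries ]-1,1], where `squeeze` acts, to ]-2⁻ⁿ,2⁻ⁿ].
stage : ℕ → Bool → Automorphism
stage n false = identity
stage n true  = inverse (zoom n) ∙ squeeze ∙ zoom n

stage-fixes : ∀ n b x → ¬ Near n x → stage n b · x ≈ x
stage-fixes n false x far = ≈-refl {x}
stage-fixes n true  x far = ≈-trans {stage n true · x} {inverse (zoom n) · zoom n · x} {x}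
  (·-cong (inverse (zoom n)) {squeeze · zoom n · x} {zoom n · x} (squeeze-fixes (zoom n · x) far))
  (inverseˡ (zoom n) x)

stage-moves : ∀ n x → Near (ℕ.suc n) x → ¬ Near (ℕ.suc n) (stage n true · x)
stage-moves n x near near′ = squeeze-moves (zoom n · x) near
  (inside-resp-≈ {zoom (ℕ.suc n) · stage n true · x} {scale 2ℚ · squeeze · zoom n · x}
    (·-cong (scale 2ℚ) {zoom n · stage n true · x} {squeeze · zoom n · x} (inverseʳ (zoom n) (squeeze · zoom n · x)))
    near′)

-- For at most one value of the n-th digit does x stay near 0.

stage-separates : ∀ n b c x → Near (ℕ.suc n) (stage n b · x) → Near (ℕ.suc n) (stage n c · x) → b ≡ c
stage-separates n false false x _  _   = refl
stage-separates n true  true  x _  _   = refl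
stage-separates n false true  x nb nc = ⊥-elim (stage-moves n x nb nc)
stage-separates n true  false x nb nc = ⊥-elim (stage-moves n x nc nb)

-- Words list the latest digit first, so the head belongs to the stage applied last.
steps : ∀ {n} → Vec Bool n → Automorphism
steps []                = identity
steps {ℕ.suc n} (b ∷ w) = stage n b ∙ steps w

-- Dyadic intervals and binary digits

midpoint : Interval → ℚ
midpoint J = ½ * (left J ℚ.+ right J)

left≤midpoint : ∀ J → left J ℚ.≤ midpoint J
left≤midpoint J = subst (ℚ._≤ midpoint J) (trans (ℚ.*-distribˡ-+ ½ (left J) (left J)) (½-halves (left J)))
  (ℚ.*-monoˡ-≤-nonNeg ½ (ℚ.+-monoʳ-≤ (left J) (left≤right J)))

midpoint≤right : ∀ J → midpoint J ℚ.≤ right J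
midpoint≤right J = subst (midpoint J ℚ.≤_) (trans (ℚ.*-distribˡ-+ ½ (right J) (right J)) (½-halves (right J)))
  (ℚ.*-monoˡ-≤-nonNeg ½ (ℚ.+-monoˡ-≤ (right J) (left≤right J)))

half : Bool → Interval → Interval
half false J = record { left = left J ; right = midpoint J ; left≤right = left≤midpoint J }
half true  J = record { left = midpoint J ; right = right J ; left≤right = midpoint≤right J }

length-half : ∀ b J → length (half b J) ≡ ½ * length J
length-half false J = solve 2 (λ l r → con ½ :* (l :+ r) :- l := con ½ :* (r :- l)) refl (left J) (right J)
length-half true  J = solve 2 (λ l r → r :- con ½ :* (l :+ r) := con ½ :* (r :- l)) refl (left J) (right J)

unitInterval : Interval
unitInterval = record { left = 0ℚ ; right = 1ℚ ; left≤right = ℚ.nonNegative⁻¹ 1ℚ }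

cell : ∀ {n} → Vec Bool n → Interval
cell []      = unitInterval
cell (b ∷ w) = half b (cell w)

length-cell : ∀ {n} (w : Vec Bool n) → length (cell w) ≡ ½^ n
length-cell []      = refl
length-cell (b ∷ w) = trans (length-half b (cell w)) (cong (½ *_) (length-cell w))

-- Successive bisection. A point equal to a midpoint goes to the lower half, since `q ∈ x` means q <
-- x.
prefix : ∀ n → [0,1] → Vec Bool n
prefix ℕ.zero    ω = []
prefix (ℕ.suc n) ω = lower (proj₁ ω) (midpoint (cell (prefix n ω))) ∷ prefix n ω

T⇔→≡ : ∀ {a b} → (T a → T b) → (T b → T a) → a ≡ b
T⇔→≡ f g = ⇔→≡ (mk⇔
  (Equivalence.to T-≡ ∘ f ∘ Equivalence.from T-≡)
  (Equivalence.to T-≡ ∘ g ∘ Equivalence.from T-≡))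

lower-cong : ∀ {x y} → x ≈ y → ∀ q → lower x q ≡ lower y q
lower-cong (x≤y , y≤x) q = T⇔→≡ (x≤y q) (y≤x q)

prefix-cong : ∀ n {ω ω′} → ω ≈ᴵ ω′ → prefix n ω ≡ prefix n ω′
prefix-cong ℕ.zero    _   = refl
prefix-cong (ℕ.suc n) {x , _} {y , _} ω≈ω′ with prefix-cong n ω≈ω′
... | eq = cong₂ _∷_ (trans (lower-cong {x} {y} ω≈ω′ _) (cong (λ w → lower y (midpoint (cell w))) eq)) eq

∈-half : ∀ ω J → ω ∈ᴶ J → ω ∈ᴶ half (lower (proj₁ ω) (midpoint J)) J
∈-half (x , _) J (l≤x , x≤r) with lower x (midpoint J) in eq
... | false = l≤x , λ q q∈x → fromWitness (∈∧∉⇒< x q∈x (subst T eq))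
... | true  = (λ q q<m → downward x (toWitness q<m) (subst T (sym eq) _)) , x≤r

∈-cell : ∀ n ω → ω ∈ᴶ cell (prefix n ω)
∈-cell ℕ.zero    (_ , ω∈) = ω∈
∈-cell (ℕ.suc n) ω        = ∈-half ω (cell (prefix n ω)) (∈-cell n ω)

-- The path of a real number under the digits of ω

walk : ℕ → [0,1] → Automorphism
walk n ω = steps (prefix n ω)

Far : ℕ → [0,1] → ℝ → Set
Far n ω x = ¬ Near n (walk n ω · x)

walk-cong : ∀ n {ω ω′ x y} → prefix n ω ≡ prefix n ω′ → x ≈ y → walk n ω · x ≈ walk n ω′ · y
walk-cong n {ω} {ω′} {x} {y} eq x≈y = subst (λ w → walk n ω · x ≈ steps w · y) eq (·-cong (walk n ω) {x} {y} x≈y)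

far-cong : ∀ n {ω ω′ x y} → prefix n ω ≡ prefix n ω′ → x ≈ y → Far n ω x → Far n ω′ y
far-cong n {ω} {ω′} {x} {y} eq x≈y far near = far
  (near-resp-≈ n {walk n ω′ · y} {walk n ω · x} (≈-sym {walk n ω · x} {walk n ω′ · y} (walk-cong n {ω} {ω′} {x} {y} eq x≈y)) near)

walk-suc : ∀ {n ω x} → Far n ω x → walk (ℕ.suc n) ω · x ≈ walk n ω · x
walk-suc {n} {ω} {x} = stage-fixes n (lower (proj₁ ω) (midpoint (cell (prefix n ω)))) (walk n ω · x)

-- A far point is fixed by the next stage, and the next neighbourhood is contained in the present
-- one.
far-suc : ∀ {n ω x} → Far n ω x → Far (ℕ.suc n) ω x
far-suc {n} {ω} {x} far near = far (near-resp-≈ n {walk (ℕ.suc n) ω · x} {walk n ω · x} (walk-suc {n} {ω} {x} far)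
  (near-pred n (walk (ℕ.suc n) ω · x) near))

walk-stable : ∀ {n m ω x} → n ℕ.≤′ m → Far n ω x → Far m ω x × walk m ω · x ≈ walk n ω · x
walk-stable {n} {ω = ω} {x} ℕ.≤′-refl far = far , ≈-refl {walk n ω · x}
walk-stable {n} {ℕ.suc m} {ω} {x} (ℕ.≤′-step n≤m) far =
  let (far′ , eq) = walk-stable {ω = ω} {x} n≤m far
  in far-suc {m} {ω} {x} far′ ,
     ≈-trans {walk (ℕ.suc m) ω · x} {walk m ω · x} {walk n ω · x} (walk-suc {m} {ω} {x} far′) eq

-- Leaving is irreversible, so both walks were near one stage earlier and share that prefix by
-- induction. Both therefore enter the last stage at the same point, where `stage-separates`
-- identifies the last digits.
near-unique : ∀ n {ω ω′ x} → Near n (walk n ω · x) → Near n (walk n ω′ · x) → prefix n ω ≡ prefix n ω′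
near-unique ℕ.zero    _ _ = refl
near-unique (ℕ.suc n) {ω} {ω′} {x} near near′ with near-unique n {ω} {ω′} {x} (earlier ω near) (earlier ω′ near′)
  where
  earlier : ∀ ω → Near (ℕ.suc n) (walk (ℕ.suc n) ω · x) → Near n (walk n ω · x)
  earlier ω near = decidable-stable (near? n (walk n ω · x)) λ far → far-suc {n} {ω} {x} far near
... | eq with prefix n ω | prefix n ω′
near-unique (ℕ.suc n) {ω} {ω′} {x} near near′ | refl | w | _ =
  cong (_∷ w) (stage-separates n _ _ (steps w · x) near near′)

-- The points that never leave the neighbourhoods of 0 form the gap of ω.

Trapped : [0,1] → ℝ → Set
Trapped ω x = ∀ n → Near n (walk n ω · x)

-- The graph of the order isomorphism determined by ω from the complement of
-- the gap of ω onto the complement of 0.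

Moves : [0,1] → ℝ → ℝ → Set
Moves ω x y = ∃[ n ] Far n ω x × walk n ω · x ≈ y

far-mono : ∀ {m n ω x y} → m ℕ.≤ n → Far m ω x → walk m ω · x ≈ y → Far n ω x × walk n ω · x ≈ y
far-mono {m} {n} {ω} {x} {y} m≤n far eq =
  let (far′ , eq′) = walk-stable {m} {n} {ω} {x} (ℕ.≤⇒≤′ m≤n) far
  in far′ , ≈-trans {walk n ω · x} {walk m ω · x} {y} eq′ eq

-- From the later of two escape stages on, one automorphism realises both pairs. In this way `Moves`
-- inherits the order properties of automorphisms.
moves-common : ∀ {ω x y x′ y′} → Moves ω x y → Moves ω x′ y′ →
               ∃[ n ] walk n ω · x ≈ y × walk n ω · x′ ≈ y′
moves-common {ω} {x} {y} {x′} {y′} (m , far , eq) (n , far′ , eq′) =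
  m ℕ.⊔ n , proj₂ (far-mono {ω = ω} {x} {y} (ℕ.m≤m⊔n m n) far eq) , proj₂ (far-mono {ω = ω} {x′} {y′} (ℕ.m≤n⊔m m n) far′ eq′)

moves-mono-≤ : ∀ {ω x y x′ y′} → Moves ω x y → Moves ω x′ y′ → x ≤ x′ → y ≤ y′
moves-mono-≤ {ω} {x} {y} {x′} {y′} moves moves′ x≤x′ q q∈y =
  let (n , eq , eq′) = moves-common {ω} {x} {y} {x′} {y′} moves moves′
  in proj₁ eq′ q (x≤x′ _ (proj₂ eq q q∈y))

moves-cancel-≤ : ∀ {ω x y x′ y′} → Moves ω x y → Moves ω x′ y′ → y ≤ y′ → x ≤ x′
moves-cancel-≤ {ω} {x} {y} {x′} {y′} moves moves′ y≤y′ =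
  let (n , eq , eq′) = moves-common {ω} {x} {y} {x′} {y′} moves moves′
  in ·-cancel-≤ (walk n ω) {x} {x′} λ q q∈ → proj₂ eq′ q (y≤y′ q (proj₁ eq q q∈))

moves-⇔-≈ : ∀ {ω x y x′ y′} → Moves ω x y → Moves ω x′ y′ → y ≈ y′ ⇔ x ≈ x′
moves-⇔-≈ {ω} {x} {y} {x′} {y′} m m′ = mk⇔
  (λ (p , q) → moves-cancel-≤ {ω} {x} {y} {x′} {y′} m m′ p , moves-cancel-≤ {ω} {x′} {y′} {x} {y} m′ m q)
  (λ (p , q) → moves-mono-≤ {ω} {x} {y} {x′} {y′} m m′ p , moves-mono-≤ {ω} {x′} {y′} {x} {y} m′ m q)

moves-⇔-< : ∀ {ω x y x′ y′} → Moves ω x y → Moves ω x′ y′ → y < y′ ⇔ x < x′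
moves-⇔-< {ω} {x} {y} {x′} {y′} m m′ =
  let (n , (≤y , y≤) , (≤y′ , y′≤)) = moves-common {ω} {x} {y} {x′} {y′} m m′
  in mk⇔ (λ (q , q∈y′ , q∉y) → ·-cancel-< (walk n ω) {x} {x′} (q , y′≤ q q∈y′ , q∉y ∘ ≤y q))
         (λ x<x′ → let (q , q∈ , q∉) = ·-mono-< (walk n ω) {x} {x′} x<x′ in q , ≤y′ q q∈ , q∉ ∘ y≤ q)

moves-resp : ∀ {ω ω′ x x′ y} → ω ≈ᴵ ω′ → x ≈ x′ → Moves ω x y → Moves ω′ x′ y
moves-resp {ω} {ω′} {x} {x′} {y} ω≈ω′ x≈x′ (n , far , eq) =
  n , far-cong n {ω} {ω′} {x} {x′} (prefix-cong n {ω} {ω′} ω≈ω′) x≈x′ far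
    , ≈-trans {walk n ω′ · x′} {walk n ω · x} {y}
        (≈-sym {walk n ω · x} {walk n ω′ · x′} (walk-cong n {ω} {ω′} {x} {x′} (prefix-cong n {ω} {ω′} ω≈ω′) x≈x′)) eq

trapped-resp : ∀ {ω ω′ x x′} → ω ≈ᴵ ω′ → x ≈ x′ → Trapped ω x → Trapped ω′ x′
trapped-resp {ω} {ω′} {x} {x′} ω≈ω′ x≈x′ trapped n = near-resp-≈ n {walk n ω · x} {walk n ω′ · x′}
  (walk-cong n {ω} {ω′} {x} {x′} (prefix-cong n {ω} {ω′} ω≈ω′) x≈x′) (trapped n)

far⇒≉0 : ∀ {n y} → ¬ Near n y → ¬ (y ≈ 0ℝ)
far⇒≉0 {n} {y} far y≈0 = far (near-resp-≈ n {0ℝ} {y} (≈-sym {y} {0ℝ} y≈0) (near-0 n))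

1≉0 : ¬ (1ℝ ≈ 0ℝ)
1≉0 (1≤0 , _) = ℚ.<-irrefl refl (ℚ.<-≤-trans (ℚ.positive⁻¹ 1ℚ) (fromℚ-cancel-≤ {1ℚ} {0ℚ} 1≤0))

ℝ∖0 : Set
ℝ∖0 = Σ[ x ∈ ℝ ] ¬ (x ≈ 0ℝ)

1∖0 : ℝ∖0
1∖0 = 1ℝ , 1≉0

-- The value 1 is junk, used until x has left the n-th neighbourhood of 0.

steps-at : ∀ n → Vec Bool n → ℝ → ℝ∖0
steps-at n w x with near? n (steps w · x)
... | yes _   = 1∖0
... | no  far = steps w · x , far⇒≉0 {n} {steps w · x} far

steps-at-cong : ∀ n (w : Vec Bool n) {x y} → x ≈ y → proj₁ (steps-at n w x) ≈ proj₁ (steps-at n w y)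
steps-at-cong n w {x} {y} x≈y with near? n (steps w · x) | near? n (steps w · y)
... | yes _    | yes _    = ≈-refl {1ℝ}
... | yes near | no  far  = ⊥-elim (far (near-resp-≈ n {steps w · x} {steps w · y} (·-cong (steps w) {x} {y} x≈y) near))
... | no  far  | yes near = ⊥-elim (far (near-resp-≈ n {steps w · y} {steps w · x} (·-cong (steps w) {y} {x} (≈-sym {x} {y} x≈y)) near))
... | no  _    | no  _    = ·-cong (steps w) {x} {y} x≈y

steps-at-far : ∀ n (w : Vec Bool n) {x} → ¬ Near n (steps w · x) → proj₁ (steps-at n w x) ≈ steps w · x
steps-at-far n w {x} far with near? n (steps w · x)
... | yes near = ⊥-elim (far near)
... | no  _    = ≈-refl {steps w · x}

steps⁻¹-at : ∀ n → Vec Bool n → ℝ∖0 → ℝ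
steps⁻¹-at n w (y , _) = inverse (steps w) · y

-- Measurable sets and partitions

next : ℕ × ℕ → ℕ × ℕ
next (ℕ.zero  , b) = ℕ.suc b , 0
next (ℕ.suc a , b) = a , ℕ.suc b

unpair : ℕ → ℕ × ℕ
unpair ℕ.zero    = 0 , 0
unpair (ℕ.suc n) = next (unpair n)

-- The enumeration runs through each antidiagonal from (s, 0) to (0, s). A pair (suc a, 0) follows
-- (0, a), the end of the previous antidiagonal; all other successors stay on their own.
unpair-surjective : ∀ a b → ∃[ n ] unpair n ≡ (a , b)
unpair-surjective a b = onDiagonal (a ℕ.+ b) a b refl
  where
  onDiagonal : ∀ s a b → a ℕ.+ b ≡ s → ∃[ n ] unpair n ≡ (a , b)
  onDiagonal ℕ.zero    ℕ.zero    ℕ.zero _ = 0 , refl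
  onDiagonal (ℕ.suc s) (ℕ.suc a) ℕ.zero eq =
    let (n , eq′) = onDiagonal s 0 a (trans (sym (ℕ.+-identityʳ a)) (ℕ.suc-injective eq))
    in ℕ.suc n , cong next eq′
  onDiagonal s a (ℕ.suc b) eq =
    let (n , eq′) = onDiagonal s (ℕ.suc a) b (trans (sym (ℕ.+-suc a b)) eq)
    in ℕ.suc n , cong next eq′

partialSum : (ℕ → ℚ) → ℕ → ℚ
partialSum f n = ∑[ i < n ] f (toℕ i)

partialSum-mono : ∀ {f} → (∀ i → 0ℚ ℚ.≤ f i) → ∀ {m n} → m ℕ.≤ n → partialSum f m ℚ.≤ partialSum f n
partialSum-mono 0≤f {n = n} ℕ.z≤n       = 0≤∑ n (λ i → 0≤f (toℕ i))
partialSum-mono {f} 0≤f (ℕ.s≤s m≤n) = ℚ.+-monoʳ-≤ (f 0) (partialSum-mono (0≤f ∘ ℕ.suc) m≤n)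

-- Moving the cutting point into `J` makes both parts genuine intervals; one of them shrinks to an
-- endpoint if `q` lies outside `J`.
clamp : ℚ → Interval → ℚ
clamp q J = left J ℚ.⊔ (q ℚ.⊓ right J)

upperPart lowerPart : ℚ → Interval → Interval
upperPart q J = record { left = clamp q J ; right = right J
                       ; left≤right = ℚ.⊔-lub (left≤right J) (ℚ.p⊓q≤q q (right J)) }
lowerPart q J = record { left = left J ; right = clamp q J ; left≤right = ℚ.p≤p⊔q (left J) _ }

0≤length : ∀ J → 0ℚ ℚ.≤ length J
0≤length J = subst (ℚ._≤ length J) (ℚ.+-inverseʳ (left J)) (ℚ.+-monoˡ-≤ (ℚ.- left J) (left≤right J))

cut-length : ∀ q J → length (upperPart q J) ℚ.+ length (lowerPart q J) ≡ length J
cut-length q J = solve 3 (λ l m r → (r :- m) :+ (m :- l) := r :- l) refl (left J) (clamp q J) (right J)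

∈-upperPart : ∀ ω q J → q ∈ proj₁ ω → ω ∈ᴶ J → ω ∈ᴶ upperPart q J
∈-upperPart (x , _) q J q∈x (l≤x , x≤r) = clamp≤x , x≤r
  where
  clamp≤x : fromℚ (clamp q J) ≤ x
  clamp≤x p p<c with ℚ.⊔-sel (left J) (q ℚ.⊓ right J)
  ... | inj₁ eq = l≤x p (fromWitness (subst (p ℚ.<_) eq (toWitness p<c)))
  ... | inj₂ eq = downward x (ℚ.<-≤-trans (subst (p ℚ.<_) eq (toWitness p<c)) (ℚ.p⊓q≤p q (right J))) q∈x

∈-lowerPart : ∀ ω q J → ¬ q ∈ proj₁ ω → ω ∈ᴶ J → ω ∈ᴶ lowerPart q J
∈-lowerPart (x , _) q J q∉x (l≤x , x≤r) = l≤x , x≤clamp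
  where
  x≤clamp : x ≤ fromℚ (clamp q J)
  x≤clamp p p∈x = fromWitness (ℚ.<-≤-trans p<q⊓r (ℚ.p≤q⊔p (left J) (q ℚ.⊓ right J)))
    where
    p<q⊓r : p ℚ.< q ℚ.⊓ right J
    p<q⊓r with ℚ.⊓-sel q (right J)
    ... | inj₁ eq = subst (p ℚ.<_) (sym eq) (∈∧∉⇒< x p∈x q∉x)
    ... | inj₂ eq = subst (p ℚ.<_) (sym eq) (toWitness (x≤r p p∈x))

module Randomization (lem : ExcludedMiddle 0ℓ) where
  open Classical lem

  -- Bisection between a member and a lower bound: either some member lies below the midpoint and
  -- replaces `s`, or the midpoint is itself a lower bound and replaces `b`.
  inf-close : ∀ S (s : ∃ S) (b : ∃[ b ] ∀ q → S q → b ℚ.≤ q) {δ} → 0ℚ ℚ.< δ →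
              ∃[ r ] S r × (∀ q → S q → r - δ ℚ.≤ q)
  inf-close S (s , s∈S) (b , b≤S) {δ} 0<δ =
    let (n , gap≤δ) = archimedean (s - b) 0<δ in bisect n s b s∈S b≤S gap≤δ
    where
    bisect : ∀ n s b → S s → (∀ q → S q → b ℚ.≤ q) → ½^ n * (s - b) ℚ.≤ δ →
             ∃[ r ] S r × (∀ q → S q → r - δ ℚ.≤ q)
    bisect ℕ.zero s b s∈S b≤S gap≤δ = s , s∈S , λ q q∈S → ℚ.≤-trans (begin
      s - δ                ≤⟨ ℚ.+-monoʳ-≤ s (ℚ.neg-antimono-≤ gap≤δ) ⟩
      s - 1ℚ * (s - b)     ≡⟨ solve 2 (λ s b → s :- con 1ℚ :* (s :- b) := b) refl s b ⟩
      b                    ∎) (b≤S q q∈S)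
      where open ℚ.≤-Reasoning
    bisect (ℕ.suc n) s b s∈S b≤S gap≤δ with lem {∃[ r ] S r × r ℚ.< ½ * (s ℚ.+ b)}
    ... | yes (r , r∈S , r<m) = bisect n r b r∈S b≤S (begin
      ½^ n * (r - b)                   ≤⟨ ℚ.*-monoˡ-≤-nonNeg (½^ n) {{ℚ.nonNegative (0≤½^ n)}} (ℚ.+-monoˡ-≤ (ℚ.- b) (ℚ.<⇒≤ r<m)) ⟩
      ½^ n * (½ * (s ℚ.+ b) - b)       ≡⟨ solve 3 (λ h s b → h :* (con ½ :* (s :+ b) :- b) := con ½ :* h :* (s :- b)) refl (½^ n) s b ⟩
      ½ * ½^ n * (s - b)               ≤⟨ gap≤δ ⟩
      δ                                ∎)
      where open ℚ.≤-Reasoning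
    ... | no none = bisect n s (½ * (s ℚ.+ b)) s∈S (λ q q∈S → ℚ.≮⇒≥ λ q<m → none (q , q∈S , q<m))
      (subst (ℚ._≤ δ) (solve 3 (λ h s b → con ½ :* h :* (s :- b) := h :* (s :- con ½ :* (s :+ b))) refl (½^ n) s b) gap≤δ)

  ∈-inf : ∀ S s b {l q} → (∀ r → S r → l ℚ.≤ r) → q ℚ.< l → q ∈ inf S s b
  ∈-inf S s b {l} l≤S q<l = fromWitness (l , l≤S , q<l)

  ∈-+ : ∀ x y {p} q r → q ∈ x → r ∈ y → p ℚ.< q ℚ.+ r → p ∈ x + y
  ∈-+ x y q r q∈x r∈y p<q+r = fromWitness (q ℚ.+ r , (q , r , q∈x , r∈y , refl) , p<q+r)

  ∈-inf+inf : ∀ S s b S′ s′ b′ {p l} → p ℚ.< l → (∀ q r → S q → S′ r → l ℚ.≤ q ℚ.+ r) →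
              p ∈ inf S s b + inf S′ s′ b′
  ∈-inf+inf S s b S′ s′ b′ {p} {l} p<l l≤S+S′ =
    let 0<δ = 0<eighth (p<q⇒0<q-p p<l)
        (q , q∈S  , q≤S)  = inf-close S  s  b  0<δ
        (r , r∈S′ , r≤S′) = inf-close S′ s′ b′ 0<δ
    in ∈-+ (inf S s b) (inf S′ s′ b′) (q - δ - δ) (r - δ - δ)
         (∈-inf S s b q≤S (p-δ<p (q - δ) 0<δ)) (∈-inf S′ s′ b′ r≤S′ (p-δ<p (r - δ) 0<δ))
         (<-minus-eighths q r p<l (l≤S+S′ q r q∈S r∈S′))
    where δ = eighth (l - p)

  subset : (P : Pred [0,1] 0ℓ) → (∀ {ω ω′} → ω ≈ᴵ ω′ → P ω → P ω′) → Subset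
  subset P resp = record
    { to   = λ ω → ⌊ lem {P ω} ⌋
    ; cong = λ {ω} {ω′} ω≈ω′ → T⇔→≡
        (λ ω∈ → fromWitness (resp ω≈ω′ (toWitness ω∈)))
        (λ ω′∈ → fromWitness (resp (≈ᴵ-sym {ω} {ω′} ω≈ω′) (toWitness ω′∈)))
    }

  ∈-resp : ∀ (A : Subset) {ω ω′} → ω ≈ᴵ ω′ → ⟦ A ⟧ ω → ⟦ A ⟧ ω′
  ∈-resp A ω≈ω′ = subst T (Func.cong A ω≈ω′)

  infixr 7 _∩ˢ_

  _∩ˢ_ : Subset → Subset → Subset
  A ∩ˢ B = subset (⟦ A ⟧ ∩ ⟦ B ⟧) λ ω≈ω′ (a , b) → ∈-resp A ω≈ω′ a , ∈-resp B ω≈ω′ b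

  ∁ˢ : Subset → Subset
  ∁ˢ A = subset (∁ ⟦ A ⟧) λ {ω} {ω′} ω≈ω′ ω∉A ω′∈A → ω∉A (∈-resp A (≈ᴵ-sym {ω} {ω′} ω≈ω′) ω′∈A)

  -- Carathéodory's criterion in terms of covers, so that no sum of reals occurs.

  Splits : Subset → Set
  Splits A = ∀ (E : Subset) {t u} → Covered ⟦ E ⟧ t → t ℚ.< u →
    ∃₂ λ r s → Covered (⟦ E ⟧ ∩ ⟦ A ⟧) r × Covered (⟦ E ⟧ ∩ ∁ ⟦ A ⟧) s × r ℚ.+ s ℚ.< u

  -- If every pair of covers had total at least `u`, then `t` < `u` would lie in the sum of the two
  -- outer measures, hence in the outer measure of E, which is at most `t`.
  measurable⇒splits : ∀ A → Measurable A → Splits A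
  measurable⇒splits A measurable E {t} {u} covered t<u
    with lem {∃₂ λ r s → Covered (⟦ E ⟧ ∩ ⟦ A ⟧) r × Covered (⟦ E ⟧ ∩ ∁ ⟦ A ⟧) s × r ℚ.+ s ℚ.< u}
  ... | yes found = found
  ... | no  none  = ⊥-elim (ℚ.<-irrefl refl (toWitness (λ*≤ {⟦ E ⟧} covered t (proj₂ (measurable E) t
    (∈-inf+inf _ (coverable E∩A) (0≤totals E∩A) _ (coverable E∖A) (0≤totals E∖A) t<u
      λ r s r∈ s∈ → ℚ.≮⇒≥ λ r+s<u → none (r , s , r∈ , s∈ , r+s<u))))))
    where
    E∩A = ⟦ E ⟧ ∩ ⟦ A ⟧
    E∖A = ⟦ E ⟧ ∩ ∁ ⟦ A ⟧

  -- One inequality is subadditivity. For the other, a cover of E with total below `q + r` would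
  -- split into covers whose totals again sum to less, although `q` and `r` are below all covers of
  -- the respective parts.
  splits⇒measurable : ∀ A → Splits A → Measurable A
  splits⇒measurable A splits E = below , above
    where
    E∩A = ⟦ E ⟧ ∩ ⟦ A ⟧
    E∖A = ⟦ E ⟧ ∩ ∁ ⟦ A ⟧

    E⊆ : ⟦ E ⟧ ⊆ E∩A ∪ E∖A
    E⊆ {ω} ω∈E with T? (Func.to A ω)
    ... | yes ω∈A = inj₁ (ω∈E , ω∈A)
    ... | no  ω∉A = inj₂ (ω∈E , ω∉A)

    below : λ* ⟦ E ⟧ ≤ λ* E∩A + λ* E∖A
    below p p∈ =
      let (l , l≤ , p<l) = toWitness p∈
      in ∈-inf+inf _ (coverable E∩A) (0≤totals E∩A) _ (coverable E∖A) (0≤totals E∖A) p<l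
           λ r s r∈ s∈ → l≤ (r ℚ.+ s) (covered-mono {⟦ E ⟧} {E∩A ∪ E∖A} E⊆ (covered-∪ {E∩A} {E∖A} r∈ s∈))

    above : λ* E∩A + λ* E∖A ≤ λ* ⟦ E ⟧
    above p p∈ with toWitness p∈
    ... | _ , (q , r , q∈ , r∈ , refl) , p<q+r =
      let (k , k≤ , q<k) = toWitness q∈
          (l , l≤ , r<l) = toWitness r∈
      in fromWitness (q ℚ.+ r , (λ t covered → ℚ.≮⇒≥ λ t<q+r →
           let (s , s′ , s∈ , s′∈ , s+s′<q+r) = splits E covered t<q+r
           in ℚ.<-asym s+s′<q+r (ℚ.+-mono-< (ℚ.<-≤-trans q<k (k≤ s s∈)) (ℚ.<-≤-trans r<l (l≤ s′ s′∈)))) , p<q+r)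

  splits-resp : ∀ A B → ⟦ A ⟧ ⊆ ⟦ B ⟧ → ⟦ B ⟧ ⊆ ⟦ A ⟧ → Splits A → Splits B
  splits-resp A B A⊆B B⊆A splits E covered t<u =
    let (r , s , r∈ , s∈ , r+s<u) = splits E covered t<u
    in r , s , covered-mono {⟦ E ⟧ ∩ ⟦ B ⟧} {⟦ E ⟧ ∩ ⟦ A ⟧} (map₂ B⊆A) r∈
             , covered-mono {⟦ E ⟧ ∩ ∁ ⟦ B ⟧} {⟦ E ⟧ ∩ ∁ ⟦ A ⟧} (map₂ (_∘ A⊆B)) s∈ , r+s<u

  splits-∁ : ∀ A → Splits A → Splits (∁ˢ A)
  splits-∁ A splits E {u = u} covered t<u =
    let (r , s , r∈ , s∈ , r+s<u) = splits E covered t<u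
    in s , r , covered-mono {⟦ E ⟧ ∩ ⟦ ∁ˢ A ⟧} {⟦ E ⟧ ∩ ∁ ⟦ A ⟧} (map₂ toWitness) s∈
             , covered-mono {⟦ E ⟧ ∩ ∁ ⟦ ∁ˢ A ⟧} {⟦ E ⟧ ∩ ⟦ A ⟧}
                 (map₂ λ ω∉∁A → decidable-stable (T? _) (ω∉∁A ∘ fromWitness)) r∈
             , subst (ℚ._< u) (ℚ.+-comm r s) r+s<u

  -- E is split by A, and then E ∩ A by B with the budget `u - s` left over. The complement collects
  -- the two discarded parts.
  splits-∩ : ∀ A B → Splits A → Splits B → Splits (A ∩ˢ B)
  splits-∩ A B splitsA splitsB E {u = u} covered t<u =
    let (r , s , r∈ , s∈ , r+s<u) = splitsA E covered t<u
        r<u-s = subst (ℚ._< u - s) (solve 2 (λ r s → r :+ s :- s := r) refl r s) (ℚ.+-monoˡ-< (ℚ.- s) r+s<u)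
        (r₁ , r₂ , r₁∈ , r₂∈ , r₁+r₂<u-s) = splitsB (E ∩ˢ A)
          (covered-mono {⟦ E ∩ˢ A ⟧} {⟦ E ⟧ ∩ ⟦ A ⟧} toWitness r∈) r<u-s
    in r₁ , r₂ ℚ.+ s
     , covered-mono {⟦ E ⟧ ∩ ⟦ A ∩ˢ B ⟧} {⟦ E ∩ˢ A ⟧ ∩ ⟦ B ⟧}
         (λ (ω∈E , ω∈) → fromWitness (ω∈E , proj₁ (toWitness ω∈)) , proj₂ (toWitness ω∈)) r₁∈
     , covered-mono {⟦ E ⟧ ∩ ∁ ⟦ A ∩ˢ B ⟧} {(⟦ E ∩ˢ A ⟧ ∩ ∁ ⟦ B ⟧) ∪ (⟦ E ⟧ ∩ ∁ ⟦ A ⟧)} outside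
         (covered-∪ {⟦ E ∩ˢ A ⟧ ∩ ∁ ⟦ B ⟧} {⟦ E ⟧ ∩ ∁ ⟦ A ⟧} r₂∈ s∈)
     , subst₂ ℚ._<_ (ℚ.+-assoc r₁ r₂ s) (solve 2 (λ u s → u :- s :+ s := u) refl u s) (ℚ.+-monoˡ-< s r₁+r₂<u-s)
    where
    outside : ⟦ E ⟧ ∩ ∁ ⟦ A ∩ˢ B ⟧ ⊆ (⟦ E ∩ˢ A ⟧ ∩ ∁ ⟦ B ⟧) ∪ (⟦ E ⟧ ∩ ∁ ⟦ A ⟧)
    outside {ω} (ω∈E , ω∉A∩B) with T? (Func.to A ω)
    ... | yes ω∈A = inj₁ (fromWitness (ω∈E , ω∈A) , λ ω∈B → ω∉A∩B (fromWitness (ω∈A , ω∈B)))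
    ... | no  ω∉A = inj₂ (ω∈E , ω∉A)

  -- The slack `u - t` pays for a cover of A, and the given cover of E serves unchanged outside A.
  splits-null : ∀ A → λ* ⟦ A ⟧ ≈ 0ℝ → Splits A
  splits-null A (λ*A≤0 , _) E {t} {u} covered t<u =
    let (r , r∈ , r<u-t) = null⇒covered {⟦ A ⟧} λ*A≤0 (p<q⇒0<q-p t<u)
    in r , t , covered-mono {⟦ E ⟧ ∩ ⟦ A ⟧} {⟦ A ⟧} proj₂ r∈
             , covered-mono {⟦ E ⟧ ∩ ∁ ⟦ A ⟧} {⟦ E ⟧} proj₁ covered
             , subst (r ℚ.+ t ℚ.<_) (solve 2 (λ u t → u :- t :+ t := u) refl u t) (ℚ.+-monoˡ-< t r<u-t)

  -- The supremum is reached as an infimum of upper bounds: for an almost least bound `r`, the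
  -- number `r - δ` is too small to be a bound, so some partial sum attains it.
  partialSum-close : ∀ {f t δ} → (∀ i → 0ℚ ℚ.≤ f i) → (∀ n → partialSum f n ℚ.≤ t) → 0ℚ ℚ.< δ →
                     ∃[ N ] ∀ n → partialSum f n ℚ.≤ partialSum f N ℚ.+ δ
  partialSum-close {f} {t} {δ} 0≤f f≤t 0<δ =
    let (η , 0<η , η<δ) = ℚ.<-dense 0<δ
        (r , f≤r , r-η≤) = inf-close Bound (t , f≤t) (0ℚ , λ _ f≤b → f≤b 0) 0<η
    in find r η η<δ f≤r r-η≤
    where
    Bound : Pred ℚ 0ℓ
    Bound b = ∀ n → partialSum f n ℚ.≤ b

    find : ∀ r η → η ℚ.< δ → Bound r → (∀ b → Bound b → r - η ℚ.≤ b) → ∃[ N ] Bound (partialSum f N ℚ.+ δ)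
    find r η η<δ f≤r r-η≤ with lem {∃[ N ] r - δ ℚ.≤ partialSum f N}
    ... | yes (N , r-δ≤) = N , λ n → ℚ.≤-trans (f≤r n)
      (subst (ℚ._≤ partialSum f N ℚ.+ δ) (solve 2 (λ r δ → r :- δ :+ δ := r) refl r δ) (ℚ.+-monoˡ-≤ δ r-δ≤))
    ... | no  none = ⊥-elim (ℚ.<-irrefl refl (ℚ.<-≤-trans (ℚ.+-monoʳ-< r (ℚ.neg-antimono-< η<δ))
      (r-η≤ (r - δ) λ n → ℚ.<⇒≤ (ℚ.≰⇒> λ r-δ≤ → none (n , r-δ≤)))))

  halfLine : ℚ → Subset
  halfLine q = record { to = λ ω → lower (proj₁ ω) q ; cong = λ {ω} {ω′} ω≈ω′ → lower-cong {proj₁ ω} {proj₁ ω′} ω≈ω′ q }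

  -- Every covering interval is cut at `q`. Totals must be rational while the series of upper parts
  -- may have an irrational sum, so a partial sum plus `δ` bounds it. The lower parts get `t` minus
  -- that partial sum, and both bounds add up to `t` + `δ` < `u`.
  splits-halfLine : ∀ q → Splits (halfLine q)
  splits-halfLine q E {t} {u} (J , covers , total≤t) t<u =
    let (δ , 0<δ , δ<u-t) = ℚ.<-dense (p<q⇒0<q-p t<u)
        (N , S⁺≤) = partialSum-close {length ∘ upperPart q ∘ J} {t} (0≤length ∘ upperPart q ∘ J) S⁺≤t 0<δ
    in S⁺ N ℚ.+ δ , t - S⁺ N
     , (upperPart q ∘ J , (λ ω (ω∈E , ω∈A) → let (n , ω∈J) = covers ω ω∈E in n , ∈-upperPart ω q (J n) ω∈A ω∈J) , S⁺≤)
     , (lowerPart q ∘ J , (λ ω (ω∈E , ω∉A) → let (n , ω∈J) = covers ω ω∈E in n , ∈-lowerPart ω q (J n) ω∉A ω∈J) , S⁻≤ N)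
     , small (S⁺ N) δ δ<u-t
    where
    S⁺ S⁻ : ℕ → ℚ
    S⁺ = partialSum (length ∘ upperPart q ∘ J)
    S⁻ = partialSum (length ∘ lowerPart q ∘ J)

    small : ∀ s δ → δ ℚ.< u - t → s ℚ.+ δ ℚ.+ (t - s) ℚ.< u
    small s δ δ<u-t = subst₂ ℚ._<_ (solve 3 (λ v δ t → δ :+ t := v :+ δ :+ (t :- v)) refl s δ t)
      (solve 2 (λ u t → u :- t :+ t := u) refl u t) (ℚ.+-monoˡ-< t δ<u-t)

    S⁺≤t : ∀ n → S⁺ n ℚ.≤ t
    S⁺≤t n = ℚ.≤-trans (∑-mono-≤ n λ i → length-upperPart (J (toℕ i))) (total≤t n)
      where
      length-upperPart : ∀ K → length (upperPart q K) ℚ.≤ length K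
      length-upperPart K = ℚ.+-monoʳ-≤ (right K) (ℚ.neg-antimono-≤ (ℚ.p≤p⊔q (left K) _))

    S⁺+S⁻≤t : ∀ n → S⁺ n ℚ.+ S⁻ n ℚ.≤ t
    S⁺+S⁻≤t n = subst (ℚ._≤ t)
      (trans (sum-cong-≗ {n} (λ i → sym (cut-length q (J (toℕ i)))))
             (∑-distrib-+ {n} (λ i → length (upperPart q (J (toℕ i)))) (λ i → length (lowerPart q (J (toℕ i))))))
      (total≤t n)

    S⁻≤ : ∀ N n → S⁻ n ℚ.≤ t - S⁺ N
    -- The joint bound `t` compares both sums at one index, so the larger of `N` and `n` is used.
    S⁻≤ N n = begin
      S⁻ n                   ≤⟨ partialSum-mono (0≤length ∘ lowerPart q ∘ J) (ℕ.m≤n⊔m N n) ⟩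
      S⁻ m                   ≡⟨ cancel (S⁺ m) (S⁻ m) ⟩
      S⁺ m ℚ.+ S⁻ m - S⁺ m   ≤⟨ ℚ.+-mono-≤ (S⁺+S⁻≤t m) (ℚ.neg-antimono-≤ (partialSum-mono (0≤length ∘ upperPart q ∘ J) (ℕ.m≤m⊔n N n))) ⟩
      t - S⁺ N               ∎
      where
      open ℚ.≤-Reasoning
      m = N ℕ.⊔ n
      cancel : ∀ v l → l ≡ v ℚ.+ l - v
      cancel = solve 2 (λ v l → l := v :+ l :- v) refl

  -- Functions that factor through a finite measurable partition

  fiber : ∀ {n} → Func [0,1]-setoid (≡.setoid (Fin n)) → Fin n → Subset
  fiber f i = record
    { to   = λ ω → ⌊ Func.to f ω Fin.≟ i ⌋
    ; cong = λ ω≈ω′ → cong (λ j → ⌊ j Fin.≟ i ⌋) (Func.cong f ω≈ω′)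
    }

  record Finitary {X : Set} (h : [0,1] → X) : Set where
    field
      partition : Partition
      decode    : Fin (Partition.size partition) → X
      decodes   : ∀ ω → h ω ≡ decode (Func.to (Partition.index partition) ω)

  bits : Bool → Fin 2
  bits = Inverse.from Fin.2↔Bool

  unbits : Fin 2 → Bool
  unbits = Inverse.to Fin.2↔Bool

  keep : Bool → Subset → Subset
  keep true  A = A
  keep false A = ∁ˢ A

  splits-keep : ∀ b A → Splits A → Splits (keep b A)
  splits-keep true  A splits = splits
  splits-keep false A splits = splits-∁ A splits

  ∈-keep : ∀ b A ω → Func.to A ω ≡ b → ⟦ keep b A ⟧ ω
  ∈-keep true  A ω eq = subst T (sym eq) _
  ∈-keep false A ω eq = fromWitness (λ ω∈A → subst T eq ω∈A)

  keep-∈ : ∀ b A ω → ⟦ keep b A ⟧ ω → Func.to A ω ≡ b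
  keep-∈ true  A ω ω∈ = Equivalence.to T-≡ ω∈
  keep-∈ false A ω ω∈ with Func.to A ω | toWitness ω∈
  ... | false | _   = refl
  ... | true  | ω∉A = ⊥-elim (ω∉A _)

  -- Each piece is refined by a set that may depend on the value of `h` there. Binary digits need
  -- this, as the midpoint deciding a digit depends on the earlier ones.
  finitary-split : ∀ {X} {h : [0,1] → X} → Finitary h → (A : X → Subset) → (∀ x → Splits (A x)) →
                   Finitary (λ ω → h ω , Func.to (A (h ω)) ω)
  finitary-split {X} {h} H A splits = record
    { partition = record
      { size       = size ℕ.* 2
      ; index      = index′
      ; measurable = λ k → splits⇒measurable (fiber index′ k) (splits-fiber k)
      }
    ; decode    = λ k → let (i , b) = Fin.remQuot {size} 2 k in decode i , unbits b
    ; decodes   = λ ω → trans (cong₂ _,_ (decodes ω) (trans (cong (λ x → Func.to (A x) ω) (decodes ω)) (sym (Inverse.inverseˡ Fin.2↔Bool refl))))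
                          (cong (λ (i , b) → decode i , unbits b) (sym (Fin.remQuot-combine (Func.to index ω) (bit ω))))
    }
    where
    open Finitary H
    open Partition partition

    bit : [0,1] → Fin 2
    -- Using the decoded index instead of `h ω` lets invariance under `_≈ᴵ_` come from `index`.
    bit ω = bits (Func.to (A (decode (Func.to index ω))) ω)

    index′ : Func [0,1]-setoid (≡.setoid (Fin (size ℕ.* 2)))
    index′ = record
      { to   = λ ω → Fin.combine (Func.to index ω) (bit ω)
      ; cong = λ {ω} {ω′} ω≈ω′ → cong₂ Fin.combine (Func.cong index ω≈ω′)
          (trans (cong bits (Func.cong (A (decode (Func.to index ω))) ω≈ω′))
                 (cong (λ i → bits (Func.to (A (decode i)) ω′)) (Func.cong index ω≈ω′)))
      }

    splits-combine : ∀ i b → Splits (fiber index′ (Fin.combine i b))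
    splits-combine i b = splits-resp (piece i ∩ˢ B) (fiber index′ (Fin.combine i b)) into out
      (splits-∩ (piece i) B (measurable⇒splits (piece i) (measurable i)) (splits-keep (unbits b) (A (decode i)) (splits (decode i))))
      where
      B = keep (unbits b) (A (decode i))

      into : ⟦ piece i ∩ˢ B ⟧ ⊆ ⟦ fiber index′ (Fin.combine i b) ⟧
      into {ω} ω∈ with toWitness ω∈
      ... | ω∈i , ω∈B with toWitness {a? = Func.to index ω Fin.≟ i} ω∈i
      ... | refl = fromWitness (cong (Fin.combine i) (trans (cong bits (keep-∈ (unbits b) (A (decode i)) ω ω∈B)) (Inverse.inverseʳ Fin.2↔Bool refl)))

      out : ⟦ fiber index′ (Fin.combine i b) ⟧ ⊆ ⟦ piece i ∩ˢ B ⟧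
      out {ω} ω∈ with Fin.combine-injective (Func.to index ω) (bit ω) i b (toWitness {a? = Fin.combine (Func.to index ω) (bit ω) Fin.≟ Fin.combine i b} ω∈)
      ... | refl , eq = fromWitness (fromWitness refl , ∈-keep (unbits b) (A (decode i)) ω
        (trans (sym (Inverse.inverseˡ Fin.2↔Bool refl)) (cong unbits eq)))

    splits-fiber : ∀ k → Splits (fiber index′ k)
    splits-fiber k = let (i , b) = Fin.remQuot {size} 2 k in
      subst (Splits ∘ fiber index′) (Fin.combine-remQuot {size} 2 k) (splits-combine i b)

  open Partition

  finitary-map : ∀ {X Y : Set} {h : [0,1] → X} (g : X → Y) → Finitary h → Finitary (g ∘ h)
  finitary-map g H = record { partition = partition ; decode = g ∘ decode ; decodes = cong g ∘ decodes }
    where open Finitary H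

  finitary-index : ∀ P → Finitary (Func.to (index P))
  finitary-index P = record { partition = P ; decode = λ i → i ; decodes = λ _ → refl }

  finitary-prefix : ∀ {X : Set} {h : [0,1] → X} → Finitary h → ∀ n → Finitary (λ ω → h ω , prefix n ω)
  finitary-prefix H ℕ.zero    = finitary-map (_, []) H
  finitary-prefix H (ℕ.suc n) = finitary-map (λ ((x , w) , b) → x , b ∷ w)
    (finitary-split (finitary-prefix H n) (λ (_ , w) → halfLine (midpoint (cell w)))
                    (λ (_ , w) → splits-halfLine (midpoint (cell w))))

  finitary⇒simple : ∀ M {X : Set} {h : [0,1] → X} → Finitary h → (s : Section M) →
    (∀ {ω ω′} → h ω ≡ h ω′ → Structure.Eq M (Func.to s ω) (Func.to s ω′)) → Simple M s
  finitary⇒simple M H s s-factors = partition , λ i {ω} {ω′} ω∈i ω′∈i →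
    s-factors (trans (decodes ω) (trans (cong decode
      (trans (toWitness {a? = Func.to (index partition) ω Fin.≟ i} ω∈i)
             (sym (toWitness {a? = Func.to (index partition) ω′ Fin.≟ i} ω′∈i)))) (sym (decodes ω′))))
    where open Finitary H

  -- Integrals and null sets

  excise : Partition → (Z : Subset) → λ* ⟦ Z ⟧ ≈ 0ℝ → Partition
  excise P Z null = record
    { size       = ℕ.suc (size P)
    ; index      = index′
    ; measurable = λ i → splits⇒measurable (fiber index′ i) (splits-fiber i)
    }
    where
    label : Bool → Fin (size P) → Fin (ℕ.suc (size P))
    label true  _ = Fin.zero
    label false i = Fin.suc i

    index′ : Func [0,1]-setoid (≡.setoid (Fin (ℕ.suc (size P))))
    index′ = record
      { to   = λ ω → label (Func.to Z ω) (Func.to (index P) ω)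
      ; cong = λ ω≈ω′ → cong₂ label (Func.cong Z ω≈ω′) (Func.cong (index P) ω≈ω′)
      }

    splits-fiber : ∀ i → Splits (fiber index′ i)
    splits-fiber Fin.zero = splits-resp Z (fiber index′ Fin.zero) (λ {ω} → into ω) (λ {ω} → out ω) (splits-null Z null)
      where
      into : ∀ ω → ⟦ Z ⟧ ω → ⟦ fiber index′ Fin.zero ⟧ ω
      into ω ω∈Z with Func.to Z ω
      ... | true = _
      out : ∀ ω → ⟦ fiber index′ Fin.zero ⟧ ω → ⟦ Z ⟧ ω
      out ω ω∈ with Func.to Z ω
      ... | true = _
    splits-fiber (Fin.suc i) = splits-resp (piece P i ∩ˢ ∁ˢ Z) (fiber index′ (Fin.suc i)) (λ {ω} → into ω) (λ {ω} → out ω)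
      (splits-∩ (piece P i) (∁ˢ Z) (measurable⇒splits (piece P i) (measurable P i)) (splits-∁ Z (splits-null Z null)))
      where
      into : ∀ ω → ⟦ piece P i ∩ˢ ∁ˢ Z ⟧ ω → ⟦ fiber index′ (Fin.suc i) ⟧ ω
      into ω ω∈ with toWitness ω∈
      ... | ω∈i , ω∉Z with Func.to Z ω | toWitness ω∉Z
      ... | true  | ∉Z = ⊥-elim (∉Z _)
      ... | false | _  = fromWitness (cong Fin.suc (toWitness {a? = Func.to (index P) ω Fin.≟ i} ω∈i))
      out : ∀ ω → ⟦ fiber index′ (Fin.suc i) ⟧ ω → ⟦ piece P i ∩ˢ ∁ˢ Z ⟧ ω
      out ω ω∈ with toWitness {a? = Func.to index′ ω Fin.≟ Fin.suc i} ω∈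
      ... | eq with Func.to Z ω
      out ω ω∈ | refl | false = fromWitness (fromWitness refl , fromWitness (λ ()))

  excise-zero : ∀ P Z null ω → ⟦ piece (excise P Z null) Fin.zero ⟧ ω → ⟦ Z ⟧ ω
  excise-zero P Z null ω ω∈ with Func.to Z ω
  ... | true = _

  excise-suc : ∀ P Z null i ω → ⟦ piece (excise P Z null) (Fin.suc i) ⟧ ω → ⟦ piece P i ⟧ ω × ¬ ⟦ Z ⟧ ω
  excise-suc P Z null i ω ω∈ with Func.to Z ω
  ... | false = fromWitness (Fin.suc-injective (toWitness {a? = Fin.suc (Func.to (index P) ω) Fin.≟ Fin.suc i} ω∈)) , λ ()

  -- The null set is made a separate piece of the partition, and the estimate for `v` is kept on the
  -- others.
  upperSum-mono-ae : ∀ {u v} (Z : Subset) → λ* ⟦ Z ⟧ ≈ 0ℝ → (∀ ω → ¬ ⟦ Z ⟧ ω → proj₁ (u ω) ≤ proj₁ (v ω)) →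
                     ∀ t → UpperSum v t → UpperSum u t
  upperSum-mono-ae {u} {v} Z null u≤v t (P , c , m , 0≤c , v≤c , λ*≤m , t≡) =
    P′ , c′ , m′ , 0≤c′ , u≤c′ , λ*≤m′ , trans t≡ (sym (ℚ.+-identityˡ _))
    where
    P′ = excise P Z null
    c′ m′ : Fin (ℕ.suc (size P)) → ℚ
    -- The value 1 bounds every integrand, and the measure bound 0 makes this term vanish.
    c′ Fin.zero    = 1ℚ
    c′ (Fin.suc i) = c i
    m′ Fin.zero    = 0ℚ
    m′ (Fin.suc i) = m i

    0≤c′ : ∀ i → 0ℚ ℚ.≤ c′ i
    0≤c′ Fin.zero    = ℚ.nonNegative⁻¹ 1ℚ
    0≤c′ (Fin.suc i) = 0≤c i

    u≤c′ : ∀ i ω → ⟦ piece P′ i ⟧ ω → proj₁ (u ω) ≤ fromℚ (c′ i)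
    u≤c′ Fin.zero    ω _  = proj₂ (proj₂ (u ω))
    u≤c′ (Fin.suc i) ω ω∈ q q∈u =
      let (ω∈i , ω∉Z) = excise-suc P Z null i ω ω∈ in v≤c i ω ω∈i q (u≤v ω ω∉Z q q∈u)

    λ*≤m′ : ∀ i → λ* ⟦ piece P′ i ⟧ ≤ fromℚ (m′ i)
    λ*≤m′ Fin.zero    = proj₁ (null-⊆ {⟦ piece P′ Fin.zero ⟧} {⟦ Z ⟧} (λ {ω} → excise-zero P Z null ω) null)
    λ*≤m′ (Fin.suc i) q q∈ = λ*≤m i q
      (λ*-mono {⟦ piece P′ (Fin.suc i) ⟧} {⟦ piece P i ⟧} (λ {ω} ω∈ → proj₁ (excise-suc P Z null i ω ω∈)) q q∈)

  ∫-mono-ae : ∀ {u v} (Z : Subset) → λ* ⟦ Z ⟧ ≈ 0ℝ → (∀ ω → ¬ ⟦ Z ⟧ ω → proj₁ (u ω) ≤ proj₁ (v ω)) →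
              proj₁ (∫ u) ≤ proj₁ (∫ v)
  ∫-mono-ae {u} {v} Z null u≤v _ p∈ =
    let (l , l≤ , p<l) = toWitness p∈
    in fromWitness (l , (λ t t∈ → l≤ t (upperSum-mono-ae {u} {v} Z null u≤v t t∈)) , p<l)

  ∫-cong-ae : ∀ {u v} (Z : Subset) → λ* ⟦ Z ⟧ ≈ 0ℝ → (∀ ω → ¬ ⟦ Z ⟧ ω → u ω ≈ᴵ v ω) → ∫ u ≈ᴵ ∫ v
  ∫-cong-ae {u} {v} Z null u≈v =
    ∫-mono-ae {u} {v} Z null (λ ω ω∉Z → proj₁ (u≈v ω ω∉Z)) ,
    ∫-mono-ae {v} {u} Z null (λ ω ω∉Z → proj₂ (u≈v ω ω∉Z))

  -- Almost no ω traps a given real number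

  trap : ℝ → ∀ n → Vec Bool n
  trap x n with lem {∃[ ω ] Near n (walk n ω · x)}
  ... | yes (ω , _) = prefix n ω
  -- A junk word for the case that no ω keeps `x` near.
  ... | no  _       = replicate n false

  near⇒trap : ∀ {x} n ω → Near n (walk n ω · x) → prefix n ω ≡ trap x n
  near⇒trap {x} n ω near with lem {∃[ ω ] Near n (walk n ω · x)}
  ... | yes (ω′ , near′) = near-unique n {ω} {ω′} {x} near near′
  ... | no  none         = ⊥-elim (none (ω , near))

  -- The ω trapping the m-th point lie in one dyadic cell of length 2⁻⁽ᴺ⁺ᵐ⁺¹⁾, and these lengths add
  -- up to at most 2⁻ᴺ.
  trapped-null : ∀ (x : ℕ → ℝ) → λ* (λ ω → ∃[ m ] Trapped ω (x m)) ≈ 0ℝ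
  trapped-null x = covered⇒null λ ε 0<ε →
    let (N , ½^N≤ε) = archimedean 1ℚ 0<ε
    in ½^ N , (J N , covers N , λ n → subst (ℚ._≤ ½^ N) (sum-cong-≗ {n} (λ i → sym (length-cell (trap _ (ℕ.suc (N ℕ.+ toℕ i)))))) (∑½^ N n))
     , subst (ℚ._≤ ε) (ℚ.*-identityʳ (½^ N)) ½^N≤ε
    where
    J : ℕ → ℕ → Interval
    J N m = cell (trap (x m) (ℕ.suc (N ℕ.+ m)))

    covers : ∀ N ω → (∃[ m ] Trapped ω (x m)) → ∃[ m ] ω ∈ᴶ J N m
    covers N ω (m , trapped) = m , subst (λ w → ω ∈ᴶ cell w) (near⇒trap {x m} n ω (trapped n)) (∈-cell n ω)
      where n = ℕ.suc (N ℕ.+ m)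

  -- The isomorphism of the L¹ spaces

  ≉0⇒far : ∀ y → ¬ (y ≈ 0ℝ) → ∃[ n ] ¬ Near n y
  ≉0⇒far y y≉0 with <-cmp y 0ℝ
  ... | tri< y<0 _ _ = <0⇒far {y} y<0
  ... | tri≈ _ y≈0 _ = ⊥-elim (y≉0 y≈0)
  ... | tri> _ _ 0<y = >0⇒far {y} 0<y

  indicator-cong : ∀ {P Q : Set} → P ⇔ Q → indicator P ≈ᴵ indicator Q
  indicator-cong {P} {Q} P⇔Q with lem {P} | lem {Q}
  ... | yes _ | yes _ = ≈-refl {1ℝ}
  ... | no  _ | no  _ = ≈-refl {0ℝ}
  ... | yes p | no ¬q = ⊥-elim (¬q (Equivalence.to P⇔Q p))
  ... | no ¬p | yes q = ⊥-elim (¬p (Equivalence.from P⇔Q q))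

  indicator-injective : ∀ {P Q : Set} → indicator P ≈ᴵ indicator Q → P ⇔ Q
  indicator-injective {P} {Q} eq with lem {P} | lem {Q}
  ... | yes p | yes q = mk⇔ (λ _ → q) (λ _ → p)
  ... | no ¬p | no ¬q = mk⇔ (⊥-elim ∘ ¬p) (⊥-elim ∘ ¬q)
  ... | yes _ | no  _ = ⊥-elim (1≉0 eq)
  ... | no  _ | yes _ = ⊥-elim (1≉0 (≈-sym {0ℝ} {1ℝ} eq))

  module _ (O : StrictTotalOrder 0ℓ 0ℓ 0ℓ) where
    private module O = StrictTotalOrder O

    EventuallyEqual : (ℕ → O.Carrier) → O.Carrier → Set
    EventuallyEqual x y = ∃[ N ] ∀ n → N ℕ.≤ n → x n O.≈ y

    -- Distances are 0 or 1, so tolerance 1 already forces equality.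
    converges⇒eventually : ∀ {x y} → ConvergesTo (discrete O) x y → EventuallyEqual x y
    converges⇒eventually {x} {y} converges =
      let (N , close) = converges 1ℚ (ℚ.positive⁻¹ 1ℚ) in N , λ n N≤n → small (close n N≤n)
      where
      small : ∀ {a} → proj₁ (indicator (¬ (a O.≈ y))) < 1ℝ → a O.≈ y
      small {a} lt with lem {¬ (a O.≈ y)}
      ... | yes _   = let (_ , q∈ , q∉) = lt in ⊥-elim (q∉ q∈)
      ... | no  ¬≉ = decidable-stable lem ¬≉

    eventually⇒converges : ∀ {x y} → EventuallyEqual x y → ConvergesTo (discrete O) x y
    eventually⇒converges {x} {y} (N , eq) ε 0<ε = N , λ n N≤n → small (eq n N≤n)
      where
      small : ∀ {a} → a O.≈ y → proj₁ (indicator (¬ (a O.≈ y))) < fromℚ ε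
      small {a} a≈y with lem {¬ (a O.≈ y)}
      ... | yes a≉y = ⊥-elim (a≉y a≈y)
      ... | no  _   = 0ℚ , fromWitness 0<ε , λ 0∈ → ℚ.<-irrefl refl (toWitness {a? = 0ℚ ℚ.<? 0ℚ} 0∈)

  module _ (O O′ : StrictTotalOrder 0ℓ 0ℓ 0ℓ) where
    private
      module O  = StrictTotalOrder O
      module O′ = StrictTotalOrder O′

    -- Transforming the n-th simple section by a map that depends on the first n
    -- digits only gives a simple section again.

    measurable-transform :
      (Φ : ∀ n → Vec Bool n → O.Carrier → O′.Carrier) →
      (∀ n w {x y} → x O.≈ y → Φ n w x O′.≈ Φ n w y) →
      (f : Section (discrete O)) → MeasurableSection (discrete O) f → (g : Section (discrete O′)) →
      (Z : Pred [0,1] 0ℓ) → λ* Z ≈ 0ℝ →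
      (∀ ω → ¬ Z ω → ∃[ N ] ∀ n → N ℕ.≤ n → Φ n (prefix n ω) (Func.to f ω) O′.≈ Func.to g ω) →
      MeasurableSection (discrete O′) g
    measurable-transform Φ Φ-cong f (s , simple , s→f) g Z Z-null Φf→g = s′ , simple′ , s′→g
      where
      s′ : ℕ → Section (discrete O′)
      s′ n = record
        { to   = λ ω → Φ n (prefix n ω) (Func.to (s n) ω)
        ; cong = λ {ω} {ω′} ω≈ω′ → subst (λ w → Φ n (prefix n ω) (Func.to (s n) ω) O′.≈ Φ n w (Func.to (s n) ω′))
                   (prefix-cong n {ω} {ω′} ω≈ω′) (Φ-cong n (prefix n ω) (Func.cong (s n) ω≈ω′))
        }

      simple′ : ∀ n → Simple (discrete O′) (s′ n)
      -- The partition of `s n` is refined by the first `n` digits.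
      simple′ n = finitary⇒simple (discrete O′) (finitary-prefix (finitary-index P) n) (s′ n) factors
        where
        P = proj₁ (simple n)
        factors : ∀ {ω ω′} → (Func.to (index P) ω , prefix n ω) ≡ (Func.to (index P) ω′ , prefix n ω′) →
                  Func.to (s′ n) ω O′.≈ Func.to (s′ n) ω′
        factors {ω} {ω′} eq = subst (λ w → Φ n (prefix n ω) (Func.to (s n) ω) O′.≈ Φ n w (Func.to (s n) ω′))
          (cong proj₂ eq) (Φ-cong n (prefix n ω)
            (proj₂ (simple n) (Func.to (index P) ω′) (fromWitness (cong proj₁ eq)) (fromWitness refl)))

      s′→g : AlmostEverywhere (λ ω → ConvergesTo (discrete O′) (λ n → Func.to (s′ n) ω) (Func.to g ω))
      s′→g = null-⊆ {∁ C′} {∁ C ∪ Z} diverges (null-∪ {∁ C} {Z} s→f Z-null)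
        where
        C C′ : Pred [0,1] 0ℓ
        C ω = ConvergesTo (discrete O) (λ n → Func.to (s n) ω) (Func.to f ω)
        C′ ω = ConvergesTo (discrete O′) (λ n → Func.to (s′ n) ω) (Func.to g ω)

        converges : ∀ ω → C ω → ¬ Z ω → C′ ω
        converges ω ω∈C ω∉Z =
          let (N , sₙ≈f) = converges⇒eventually O ω∈C
              (N′ , Φf≈g) = Φf→g ω ω∉Z
          in eventually⇒converges O′ (N ℕ.⊔ N′ , λ n ≤n →
               O′.Eq.trans (Φ-cong n (prefix n ω) (sₙ≈f n (ℕ.m⊔n≤o⇒m≤o N N′ ≤n)))
                           (Φf≈g n (ℕ.m⊔n≤o⇒n≤o N N′ ≤n)))

        diverges : ∁ C′ ⊆ ∁ C ∪ Z
        diverges {ω} ω∉C′ with lem {Z ω}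
        ... | yes ω∈Z = inj₂ ω∈Z
        ... | no  ω∉Z = inj₁ λ ω∈C → ω∉C′ (converges ω ω∈C ω∉Z)

  M N : Structure
  M = discrete ℝ-strictTotalOrder
  N = discrete ℝ∖0-strictTotalOrder

  -- Which escape stage is chosen does not matter, as the point no longer moves after it. The value
  -- on trapped points is junk.
  push-at : [0,1] → ℝ → ℝ∖0
  push-at ω x with lem {∃[ n ] Far n ω x}
  ... | yes (n , far) = walk n ω · x , far⇒≉0 {n} {walk n ω · x} far
  ... | no  _         = 1∖0

  escapes : ∀ {ω x} → ¬ Trapped ω x → ∃[ n ] Far n ω x
  escapes {ω} {x} free = decidable-stable lem λ none →
    free λ n → decidable-stable (near? n (walk n ω · x)) λ far → none (n , far)

  push-moves : ∀ {ω x} → ¬ Trapped ω x → Moves ω x (proj₁ (push-at ω x))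
  push-moves {ω} {x} free with lem {∃[ n ] Far n ω x}
  ... | yes (n , far) = n , far , ≈-refl {walk n ω · x}
  ... | no  none      = ⊥-elim (none (escapes {ω} {x} free))

  -- Excluded middle may choose different stages for the two arguments, so free points are compared
  -- through `Moves`; trapped ones both receive the junk value.
  push-at-cong : ∀ {ω ω′ x x′} → ω ≈ᴵ ω′ → x ≈ x′ → proj₁ (push-at ω x) ≈ proj₁ (push-at ω′ x′)
  push-at-cong {ω} {ω′} {x} {x′} ω≈ω′ x≈x′ with lem {Trapped ω x}
  ... | no free = Equivalence.from
    (moves-⇔-≈ {ω′} {x′} {proj₁ (push-at ω x)} {x′} {proj₁ (push-at ω′ x′)}
      (moves-resp {ω} {ω′} {x} {x′} {proj₁ (push-at ω x)} ω≈ω′ x≈x′ (push-moves {ω} {x} free))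
      (push-moves {ω′} {x′} λ trapped → free (trapped-resp {ω′} {ω} {x′} {x} (≈ᴵ-sym {ω} {ω′} ω≈ω′) (≈-sym {x} {x′} x≈x′) trapped)))
    (≈-refl {x′})
  ... | yes trapped with lem {∃[ n ] Far n ω x} | lem {∃[ n ] Far n ω′ x′}
  ...   | yes (n , far) | _             = ⊥-elim (far (trapped n))
  ...   | no _          | yes (n , far) = ⊥-elim (far (trapped-resp {ω} {ω′} {x} {x′} ω≈ω′ x≈x′ trapped n))
  ...   | no _          | no _          = ≈-refl {1ℝ}

  push : Section M → Section N
  push f = record
    { to   = λ ω → push-at ω (Func.to f ω)
    ; cong = λ {ω} {ω′} ω≈ω′ → push-at-cong {ω} {ω′} {Func.to f ω} {Func.to f ω′} ω≈ω′ (Func.cong f ω≈ω′)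
    }

  TrappedAt : Section M → Pred [0,1] 0ℓ
  TrappedAt f ω = Trapped ω (Func.to f ω)

  -- Almost every value of `f` is a value of some `s k`, and these simple sections together take
  -- countably many values, to which `trapped-null` applies.
  trappedAt-null : ∀ f → MeasurableSection M f → λ* (TrappedAt f) ≈ 0ℝ
  trappedAt-null f (s , simple , s→f) =
    null-⊆ {TrappedAt f} {∁ C ∪ Z} split (null-∪ {∁ C} {Z} s→f (trapped-null (λ m → value (unpair m))))
    where
    label : ℕ → [0,1] → ℕ
    label k ω = toℕ (Func.to (index (proj₁ (simple k))) ω)

    value : ℕ × ℕ → ℝ
    value (k , i) with lem {∃[ ω ] label k ω ≡ i}
    ... | yes (ω , _) = Func.to (s k) ω
    -- Junk for indices of empty pieces and for those beyond the size of the partition.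
    ... | no  _       = 0ℝ

    value-label : ∀ k ω → value (k , label k ω) ≈ Func.to (s k) ω
    value-label k ω with lem {∃[ ω′ ] label k ω′ ≡ label k ω}
    ... | yes (ω′ , eq) = proj₂ (simple k) (Func.to (index (proj₁ (simple k))) ω) (fromWitness (Fin.toℕ-injective eq)) (fromWitness refl)
    ... | no  none      = ⊥-elim (none (ω , refl))

    C Z : Pred [0,1] 0ℓ
    C ω = ConvergesTo M (λ n → Func.to (s n) ω) (Func.to f ω)
    Z ω = ∃[ m ] Trapped ω (value (unpair m))

    split : TrappedAt f ⊆ ∁ C ∪ Z
    split {ω} trapped with lem {C ω}
    ... | no  ω∉C = inj₁ ω∉C
    ... | yes ω∈C =
      let (k , close) = converges⇒eventually ℝ-strictTotalOrder {λ n → Func.to (s n) ω} {Func.to f ω} ω∈C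
          (m , eq) = unpair-surjective k (label k ω)
          v = value (k , label k ω)
      in inj₂ (m , subst (λ p → Trapped ω (value p)) (sym eq)
           (trapped-resp {ω} {ω} {Func.to f ω} {v} (≈-refl {proj₁ ω})
             (≈-trans {Func.to f ω} {Func.to (s k) ω} {v}
               (≈-sym {Func.to (s k) ω} {Func.to f ω} (close k ℕ.≤-refl))
               (≈-sym {v} {Func.to (s k) ω} (value-label k ω))) trapped))

  push-measurable : ∀ f → MeasurableSection M f → MeasurableSection N (push f)
  push-measurable f f-measurable =
    measurable-transform ℝ-strictTotalOrder ℝ∖0-strictTotalOrder steps-at
      (λ n w {x} {y} → steps-at-cong n w {x} {y}) f f-measurable (push f)
      (TrappedAt f) (trappedAt-null f f-measurable) eventually
    where
    eventually : ∀ ω → ¬ TrappedAt f ω → ∃[ n₀ ] ∀ n → n₀ ℕ.≤ n →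
      proj₁ (steps-at n (prefix n ω) (Func.to f ω)) ≈ proj₁ (push-at ω (Func.to f ω))
    eventually ω free =
      let x = Func.to f ω
          y = proj₁ (push-at ω x)
          (n₀ , far , eq) = push-moves {ω} {x} free
      in n₀ , λ n n₀≤n →
        let (far′ , eq′) = far-mono {n₀} {n} {ω} {x} {y} n₀≤n far eq
        in ≈-trans {proj₁ (steps-at n (prefix n ω) x)} {walk n ω · x} {y} (steps-at-far n (prefix n ω) {x} far′) eq′

  -- A stage at which `y` itself is far is also an escape stage of its preimage, so every nonzero
  -- `y` has one for every ω.
  pull-at : [0,1] → ℝ∖0 → ℝ
  pull-at ω (y , y≉0) = inverse (walk (proj₁ (≉0⇒far y y≉0)) ω) · y

  inverse-moves : ∀ {ω y} n → ¬ Near n y → Moves ω (inverse (walk n ω) · y) y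
  inverse-moves {ω} {y} n far =
    n , far ∘ near-resp-≈ n {walk n ω · inverse (walk n ω) · y} {y} (inverseʳ (walk n ω) y) , inverseʳ (walk n ω) y

  pull-moves : ∀ ω y → Moves ω (pull-at ω y) (proj₁ y)
  pull-moves ω (y , y≉0) = let (n , far) = ≉0⇒far y y≉0 in inverse-moves {ω} {y} n far

  moves-respʳ : ∀ {ω x y y′} → y ≈ y′ → Moves ω x y → Moves ω x y′
  moves-respʳ {ω} {x} {y} {y′} y≈y′ (n , far , eq) = n , far , ≈-trans {walk n ω · x} {y} {y′} eq y≈y′

  pull-at-cong : ∀ {ω ω′ y y′} → ω ≈ᴵ ω′ → proj₁ y ≈ proj₁ y′ → pull-at ω y ≈ pull-at ω′ y′
  pull-at-cong {ω} {ω′} {y} {y′} ω≈ω′ y≈y′ = Equivalence.to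
    (moves-⇔-≈ {ω′} {pull-at ω y} {proj₁ y} {pull-at ω′ y′} {proj₁ y′}
      (moves-resp {ω} {ω′} {pull-at ω y} {pull-at ω y} {proj₁ y} ω≈ω′ (≈-refl {pull-at ω y}) (pull-moves ω y))
      (pull-moves ω′ y′)) y≈y′

  pull : Section N → Section M
  pull g = record
    { to   = λ ω → pull-at ω (Func.to g ω)
    ; cong = λ {ω} {ω′} ω≈ω′ → pull-at-cong {ω} {ω′} {Func.to g ω} {Func.to g ω′} ω≈ω′ (Func.cong g ω≈ω′)
    }

  -- The inverse walks eventually return the preimage at every ω, so the exceptional set is empty.
  pull-measurable : ∀ g → MeasurableSection N g → MeasurableSection M (pull g)
  pull-measurable g g-measurable =
    measurable-transform ℝ∖0-strictTotalOrder ℝ-strictTotalOrder steps⁻¹-at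
      (λ n w {x} {y} → ·-cong (inverse (steps w)) {proj₁ x} {proj₁ y}) g g-measurable (pull g) ∅ null-∅ eventually
    where
    eventually : ∀ ω → ¬ ∅ ω → ∃[ n₀ ] ∀ n → n₀ ℕ.≤ n → steps⁻¹-at n (prefix n ω) (Func.to g ω) ≈ pull-at ω (Func.to g ω)
    eventually ω _ =
      let y = proj₁ (Func.to g ω)
          x = pull-at ω (Func.to g ω)
          (n₀ , far , eq) = pull-moves ω (Func.to g ω)
      in n₀ , λ n n₀≤n →
        let (_ , eq′) = far-mono {n₀} {n} {ω} {x} {y} n₀≤n far eq
        in ≈-trans {inverse (walk n ω) · y} {inverse (walk n ω) · walk n ω · x} {x}
             (·-cong (inverse (walk n ω)) {y} {walk n ω · x} (≈-sym {walk n ω · x} {y} eq′)) (inverseˡ (walk n ω) x)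

  moves⇒free : ∀ {ω x y} → Moves ω x y → ¬ Trapped ω x
  moves⇒free (n , far , _) trapped = far (trapped n)

  push-pull : ∀ ω y → proj₁ (push-at ω (pull-at ω y)) ≈ proj₁ y
  push-pull ω y = Equivalence.from
    (moves-⇔-≈ {ω} {x} {proj₁ (push-at ω x)} {x} {proj₁ y}
      (push-moves {ω} {x} (moves⇒free {ω} {x} {proj₁ y} (pull-moves ω y))) (pull-moves ω y)) (≈-refl {x})
    where x = pull-at ω y

  L¹M≅L¹N : L¹ M ≅ L¹ N
  L¹M≅L¹N = record
    { function   = record { to = λ (f , f-measurable) → push f , push-measurable f f-measurable
                          ; cong = λ {f} {g} → push-cong (proj₁ f) (proj₁ g) }
    ; surjective = λ (g , g-measurable) → (pull g , pull-measurable g g-measurable) , λ {(f , _)} → surjective f g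
    ; isometric  = λ f g → preserves f g (λ x y → indicator (¬ (proj₁ x ≈ proj₁ y))) (λ x y → indicator (¬ (x ≈ y)))
        λ {ω} {x} {y} {x′} {y′} m m′ → indicator-cong (¬-cong-⇔ (moves-⇔-≈ {ω} {x} {proj₁ y} {x′} {proj₁ y′} m m′))
    ; preserving = λ f g → preserves f g (λ x y → indicator (proj₁ x < proj₁ y)) (λ x y → indicator (x < y))
        λ {ω} {x} {y} {x′} {y′} m m′ → indicator-cong (moves-⇔-< {ω} {x} {proj₁ y} {x′} {proj₁ y′} m m′)
    }
    where
    push-cong : ∀ f g → AlmostEverywhere (AgreeAt M f g) → AlmostEverywhere (AgreeAt N (push f) (push g))
    push-cong f g = null-⊆ {DisagreeAt N (push f) (push g)} {DisagreeAt M f g} λ {ω} disagree agree →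
      disagree (push-at-cong {ω} {ω} {Func.to f ω} {Func.to g ω} (≈-refl {proj₁ ω}) agree)

    -- `Surjective` concerns every section that agrees almost everywhere with the chosen preimage
    -- `pull g`.
    surjective : ∀ f g → AlmostEverywhere (AgreeAt M f (pull g)) → AlmostEverywhere (AgreeAt N (push f) g)
    surjective f g = null-⊆ {DisagreeAt N (push f) g} {DisagreeAt M f (pull g)} λ {ω} disagree agree →
      disagree (≈-trans {proj₁ (push-at ω (Func.to f ω))} {proj₁ (push-at ω (Func.to (pull g) ω))} {proj₁ (Func.to g ω)}
        (push-at-cong {ω} {ω} {Func.to f ω} {Func.to (pull g) ω} (≈-refl {proj₁ ω}) agree) (push-pull ω (Func.to g ω)))

    -- Distance and predicate are treated together: where neither section is trapped, `Moves`
    -- relates the values and the integrands agree.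
    preserves : ∀ ((f , _) (g , _) : ∃ (MeasurableSection M)) (R : ℝ∖0 → ℝ∖0 → [0,1]) (S : ℝ → ℝ → [0,1]) →
      (∀ {ω x y x′ y′} → Moves ω x (proj₁ y) → Moves ω x′ (proj₁ y′) → R y y′ ≈ᴵ S x x′) →
      ∫ (λ ω → R (Func.to (push f) ω) (Func.to (push g) ω)) ≈ᴵ ∫ (λ ω → S (Func.to f ω) (Func.to g ω))
    preserves (f , f-measurable) (g , g-measurable) R S R≈S =
      ∫-cong-ae {λ ω → R (Func.to (push f) ω) (Func.to (push g) ω)} {λ ω → S (Func.to f ω) (Func.to g ω)} Z Z-null
        λ ω ω∉Z → R≈S {ω} {Func.to f ω} {push-at ω (Func.to f ω)} {Func.to g ω} {push-at ω (Func.to g ω)}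
          (push-moves {ω} {Func.to f ω} (λ t → ω∉Z (fromWitness (inj₁ t))))
          (push-moves {ω} {Func.to g ω} (λ t → ω∉Z (fromWitness (inj₂ t))))
      where
      resp : ∀ (h : Section M) {ω ω′} → ω ≈ᴵ ω′ → TrappedAt h ω → TrappedAt h ω′
      resp h {ω} {ω′} ω≈ω′ = trapped-resp {ω} {ω′} {Func.to h ω} {Func.to h ω′} ω≈ω′ (Func.cong h ω≈ω′)

      -- To become a piece of a partition, the exceptional set has to be Bool-valued and invariant.
      Z : Subset
      Z = subset (TrappedAt f ∪ TrappedAt g) λ
        { {ω} {ω′} ω≈ω′ (inj₁ t) → inj₁ (resp f {ω} {ω′} ω≈ω′ t)
        ; {ω} {ω′} ω≈ω′ (inj₂ t) → inj₂ (resp g {ω} {ω′} ω≈ω′ t) }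

      Z-null : λ* ⟦ Z ⟧ ≈ 0ℝ
      Z-null = null-⊆ {⟦ Z ⟧} {TrappedAt f ∪ TrappedAt g} toWitness
        (null-∪ {TrappedAt f} {TrappedAt g} (trappedAt-null f f-measurable) (trappedAt-null g g-measurable))

  -- ℝ is Dedekind complete but ℝ∖0 has a gap at 0.

  M≇N : ¬ (M ≅ N)
  M≇N iso = contradiction
    where
    open _≅_ iso using (surjective; preserving)
    module R = StrictTotalOrder ℝ-strictTotalOrder

    F : ℝ → ℝ
    F x = proj₁ (_≅_.to iso x)

    F-mono-< : ∀ {x y} → x < y → F x < F y
    F-mono-< {x} {y} = Equivalence.from (indicator-injective (preserving x y))

    F-cancel-< : ∀ {x y} → F x < F y → x < y
    F-cancel-< {x} {y} = Equivalence.to (indicator-injective (preserving x y))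

    F⁻¹ : ∀ y → ¬ (y ≈ 0ℝ) → ∃[ x ] F x ≈ y
    F⁻¹ y y≉0 = let (x , F≈y) = surjective (y , y≉0) in x , F≈y (≈-refl {x})

    <⇒≉ : ∀ {x y} → x < y → ¬ (x ≈ y)
    <⇒≉ {x} {y} x<y x≈y = R.irrefl {x} {y} x≈y x<y

    -- The side condition keeps the intermediate point off 0, so that it belongs to `N` and has a
    -- preimage.
    preimage : ∀ {a b} → a < b → (∀ {y} → a < y → y < b → ¬ (y ≈ 0ℝ)) → ∃[ z ] a < F z × F z < b
    preimage {a} {b} a<b ≉0 =
      let (y , a<y , y<b) = <-dense {a} {b} a<b
          (z , Fz≈y) = F⁻¹ y (≉0 {y} a<y y<b)
      in z , R.<-respʳ-≈ {a} {y} {F z} (≈-sym {F z} {y} Fz≈y) a<y , R.<-respˡ-≈ {b} {y} {F z} (≈-sym {F z} {y} Fz≈y) y<b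

    -1<0 : fromℚ (ℚ.- 1ℚ) < 0ℝ
    -1<0 = fromℚ-mono-< (ℚ.negative⁻¹ (ℚ.- 1ℚ))

    0<1 : 0ℝ < 1ℝ
    0<1 = fromℚ-mono-< (ℚ.positive⁻¹ 1ℚ)

    low : ∃[ z ] fromℚ (ℚ.- 1ℚ) < F z × F z < 0ℝ
    low = preimage {fromℚ (ℚ.- 1ℚ)} {0ℝ} -1<0 λ {y} _ y<0 → <⇒≉ {y} {0ℝ} y<0

    high : ∃[ z ] 0ℝ < F z × F z < 1ℝ
    high = preimage {0ℝ} {1ℝ} 0<1 λ {y} 0<y _ y≈0 → <⇒≉ {0ℝ} {y} 0<y (≈-sym {y} {0ℝ} y≈0)

    separated : ∀ {x z} → F x < 0ℝ → 0ℝ < F z → x < z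
    separated {x} {z} Fx<0 0<Fz = F-cancel-< {x} {z} (R.trans {F x} {0ℝ} {F z} Fx<0 0<Fz)

    -- The union of all cuts whose images are negative; `high` supplies an upper bound.
    supremum : ℝ
    supremum = record
      { lower     = λ q → ⌊ lem {∃[ x ] F x < 0ℝ × q ∈ x} ⌋
      ; inhabited = let (x , _ , Fx<0) = low ; (q , q∈x) = inhabited x in q , fromWitness (x , Fx<0 , q∈x)
      ; proper    = let (z , 0<Fz , _) = high ; (q , q∉z) = proper z in q , λ q∈ →
                    let (x , Fx<0 , q∈x) = toWitness q∈
                    in R.asym {z} {x} (q , q∈x , q∉z) (separated {x} {z} Fx<0 0<Fz)
      ; downward  = λ p<q q∈ → let (x , Fx<0 , q∈x) = toWitness q∈ in fromWitness (x , Fx<0 , downward x p<q q∈x)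
      ; rounded   = λ q∈ → let (x , Fx<0 , q∈x) = toWitness q∈ ; (r , q<r , r∈x) = rounded x q∈x
                           in r , q<r , fromWitness (x , Fx<0 , r∈x)
      }

    contradiction : _
    contradiction with <-cmp (F supremum) 0ℝ
    ... | tri≈ _ eq _ = proj₂ (_≅_.to iso supremum) eq
    -- Density below 0 gives a point above the supremum whose image is still negative.
    ... | tri< Fs<0 _ _ =
      let (z , Fs<Fz , Fz<0) = preimage {F supremum} {0ℝ} Fs<0 λ {y} _ y<0 → <⇒≉ {y} {0ℝ} y<0
          (q , q∈z , q∉s) = F-cancel-< {supremum} {z} Fs<Fz
      in q∉s (fromWitness (z , Fz<0 , q∈z))
    -- Density above 0 gives a smaller upper bound `z`, yet some `x` with negative image exceeds it.
    ... | tri> _ _ 0<Fs =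
      let (z , 0<Fz , Fz<Fs) = preimage {0ℝ} {F supremum} 0<Fs λ {y} 0<y _ y≈0 → <⇒≉ {0ℝ} {y} 0<y (≈-sym {y} {0ℝ} y≈0)
          (q , q∈s , q∉z) = F-cancel-< {z} {supremum} Fz<Fs
          (x , Fx<0 , q∈x) = toWitness q∈s
      in R.asym {z} {x} (q , q∈x , q∉z) (separated {x} {z} Fx<0 0<Fz)

corollary2 : (lem : ExcludedMiddle 0ℓ) →
    let open Classical lem
        M = discrete ℝ-strictTotalOrder
        N = discrete ℝ∖0-strictTotalOrder
    in ¬ (M ≅ N) × (L¹ M ≅ L¹ N)
corollary2 lem = M≇N , L¹M≅L¹N
  where open Randomization lem
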